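{- There is an algorithm that, given a finite simple undirected graph $G$ with $n$ vertices and neighborhood diversity $\nu$, determines the winner of Arc Kayles on $G$ in time $O^*((n/\nu+1)^{\nu})$.
   Context: Arc Kayles is played by two players on a finite undirected graph $G$. The players move alternately; on a turn a player must choose an edge $\{u,v\}$ of the current graph, and then this edge and all edges sharing an endpoint with it are removed (equivalently, the play continues on $G-u-v$). A player who has no edge to choose on their turn loses. The winner is the player having a winning strategy. Two vertices $u,v$ are twins if $N(u)\setminus\{v\}=N(v)\setminus\{u\}$. The neighborhood diversity $\nu$ of $G=(V,E)$ is the minimum number $w$ such that $V$ can be partitioned into $w$ sets such that any two vertices in the same set are twins. The notation $O^*(\cdot)$ suppresses factors polynomial in the input size. -}

module Defs where

open import Data.Bool.Base using (Bool; true; false; _∧_; _∨_; not; T)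
open import Data.Bool.Properties using (∧-comm)
open import Data.Fin.Base using (Fin)
open import Data.Fin.Properties using (_≟_)
open import Data.Fin.Subset using (Subset; _-_)
open import Data.Integer.Base using (+_)
open import Data.Nat.Base using (ℕ; suc; _+_; _≤_; NonZero)
open import Data.Product.Base using (_×_; _,_; Σ-syntax)
open import Data.Rational.Base as ℚ using (ℚ; 1ℚ)
open import Data.Vec.Base using (Vec; []; _∷_; lookup; tabulate)
import Data.Vec.Functional as Vector
open import Function.Definitions using (StrictlySurjective)
open import Relation.Binary.PropositionalEquality
  using (_≡_; refl; cong; cong₂)
open import Relation.Nullary.Decidable.Core using (⌊_⌋)

import Algebra.Definitions.RawSemiring ℚ.+-*-rawSemiring as ℚ-Power

------------------------------------------------------------------------
-- Finite simple graphs

record Graph (n : ℕ) : Set where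
  field
    adj        : Fin n → Fin n → Bool
    adj-sym    : ∀ u v → adj u v ≡ adj v u
    adj-irrefl : ∀ u → adj u u ≡ false

open Graph public

Edge : ∀ {n} → Graph n → Fin n → Fin n → Set
Edge G u v = T (adj G u v)

N : ∀ {n} → Graph n → Fin n → Subset n
N G u = tabulate (adj G u)

Twins : ∀ {n} → Graph n → Fin n → Fin n → Set
Twins G u v = N G u - v ≡ N G v - u

-- The parts are the fibres of `part`; surjectivity says that none of the
-- w parts is empty.
TwinPartition : ∀ {n} → Graph n → ℕ → Set
TwinPartition {n} G w =
  Σ[ part ∈ (Fin n → Fin w) ]
    StrictlySurjective _≡_ part × (∀ u v → part u ≡ part v → Twins G u v)

NeighborhoodDiversity : ∀ {n} → Graph n → ℕ → Set
NeighborhoodDiversity G ν =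
  TwinPartition G ν × (∀ w → TwinPartition G w → ν ≤ w)

------------------------------------------------------------------------
-- Arc Kayles

-- `G ⊖ u , v` deletes every edge that meets u or v. The two vertices stay
-- behind as isolated vertices, which no later move can use.

infix 6 _⊖_,_

_⊖_,_ : ∀ {n} → Graph n → Fin n → Fin n → Graph n
_⊖_,_ {n} G u v = record
  { adj        = λ x y → adj G x y ∧ (survives x ∧ survives y)
  ; adj-sym    = λ x y →
      cong₂ _∧_ (adj-sym G x y) (∧-comm (survives x) (survives y))
  ; adj-irrefl = λ x → cong (_∧ (survives x ∧ survives x)) (adj-irrefl G x)
  }
  where
  survives : Fin n → Bool
  survives x = not (⌊ x ≟ u ⌋ ∨ ⌊ x ≟ v ⌋)

data Player : Set where
  first second : Player

-- `first` is the player about to move. An element is a strategy tree: one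
-- move at each of the owner's turns, and a continuation for every possible
-- move at each of the opponent's turns. The roles swap after each move.
-- A player without a move loses: `move` needs an edge, whereas on an
-- edgeless graph the premise of `answer` is vacuous.
data WinningStrategy {n} : Player → Graph n → Set where
  move   : ∀ {G} u v → Edge G u v →
           WinningStrategy second (G ⊖ u , v) → WinningStrategy first G
  answer : ∀ {G} →
           (∀ u v → Edge G u v → WinningStrategy first (G ⊖ u , v)) →
           WinningStrategy second G

------------------------------------------------------------------------
-- Model of computation
--
-- A first-order functional language on binary trees, essentially the
-- language F of Jones, "Computability and Complexity from a Programming
-- Perspective". Every evaluation rule costs one unit, plus the cost of its
-- premises. This is a realistic time measure: trees are represented by
-- pointers to immutable cells, the length of an environment is bounded by
-- a constant of the program, and there is no arithmetic and no equality
-- test on trees. So a pointer machine or a RAM simulates each unit in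
-- constant time (for a fixed program), and time bounds in this model carry
-- over to those machines.

infixr 5 _∙_

data Tree : Set where
  nil : Tree
  _∙_ : Tree → Tree → Tree

size : Tree → ℕ
size nil     = 1
size (a ∙ b) = suc (size a + size b)

-- Expressions over f unary, mutually recursive functions, with m variables
-- in scope (de Bruijn indices). `case e e₀ e₁` evaluates e₀ if e is nil, and
-- e₁ with head (index 0) and tail (index 1) bound if e is a pair.
data Exp (f m : ℕ) : Set where
  var  : Fin m → Exp f m
  nil  : Exp f m
  cons : Exp f m → Exp f m → Exp f m
  case : Exp f m → Exp f m → Exp f (suc (suc m)) → Exp f m
  bind : Exp f m → Exp f (suc m) → Exp f m
  call : Fin f → Exp f m → Exp f m

record Program : Set where
  field
    functions : ℕ
    body      : Vec (Exp functions 1) functions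
    main      : Exp functions 1

open Program public

module _ {f : ℕ} (bodies : Vec (Exp f 1) f) where

  infix 4 _⊢_⇓_⟨_⟩

  -- ρ ⊢ e ⇓ v ⟨ t ⟩: in environment ρ, e evaluates to v in time t.
  data _⊢_⇓_⟨_⟩ {m} (ρ : Vec Tree m) : Exp f m → Tree → ℕ → Set where
    ⇓var   : ∀ {x} → ρ ⊢ var x ⇓ lookup ρ x ⟨ 1 ⟩
    ⇓nil   : ρ ⊢ nil ⇓ nil ⟨ 1 ⟩
    ⇓cons  : ∀ {e₁ e₂ a b s t} →
             ρ ⊢ e₁ ⇓ a ⟨ s ⟩ → ρ ⊢ e₂ ⇓ b ⟨ t ⟩ →
             ρ ⊢ cons e₁ e₂ ⇓ a ∙ b ⟨ suc (s + t) ⟩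
    ⇓case₀ : ∀ {e e₀ e₁ v s t} →
             ρ ⊢ e ⇓ nil ⟨ s ⟩ → ρ ⊢ e₀ ⇓ v ⟨ t ⟩ →
             ρ ⊢ case e e₀ e₁ ⇓ v ⟨ suc (s + t) ⟩
    ⇓case₁ : ∀ {e e₀ e₁ a b v s t} →
             ρ ⊢ e ⇓ a ∙ b ⟨ s ⟩ → (a ∷ b ∷ ρ) ⊢ e₁ ⇓ v ⟨ t ⟩ →
             ρ ⊢ case e e₀ e₁ ⇓ v ⟨ suc (s + t) ⟩
    ⇓bind  : ∀ {e e₁ a v s t} →
             ρ ⊢ e ⇓ a ⟨ s ⟩ → (a ∷ ρ) ⊢ e₁ ⇓ v ⟨ t ⟩ →
             ρ ⊢ bind e e₁ ⇓ v ⟨ suc (s + t) ⟩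
    ⇓call  : ∀ {g e a v s t} →
             ρ ⊢ e ⇓ a ⟨ s ⟩ → (a ∷ []) ⊢ lookup bodies g ⇓ v ⟨ t ⟩ →
             ρ ⊢ call g e ⇓ v ⟨ suc (s + t) ⟩

  ⇓-deterministic : ∀ {m} {ρ : Vec Tree m} {e v w s t} →
                    ρ ⊢ e ⇓ v ⟨ s ⟩ → ρ ⊢ e ⇓ w ⟨ t ⟩ → (v , s) ≡ (w , t)
  ⇓-deterministic ⇓var ⇓var = refl
  ⇓-deterministic ⇓nil ⇓nil = refl
  ⇓-deterministic (⇓cons p q) (⇓cons p′ q′)
    with refl ← ⇓-deterministic p p′ | refl ← ⇓-deterministic q q′ = refl
  ⇓-deterministic (⇓case₀ p q) (⇓case₀ p′ q′)
    with refl ← ⇓-deterministic p p′ | refl ← ⇓-deterministic q q′ = refl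
  ⇓-deterministic (⇓case₀ p q) (⇓case₁ p′ q′)
    with () ← ⇓-deterministic p p′
  ⇓-deterministic (⇓case₁ p q) (⇓case₀ p′ q′)
    with () ← ⇓-deterministic p p′
  ⇓-deterministic (⇓case₁ p q) (⇓case₁ p′ q′)
    with refl ← ⇓-deterministic p p′
    with refl ← ⇓-deterministic q q′ = refl
  ⇓-deterministic (⇓bind p q) (⇓bind p′ q′)
    with refl ← ⇓-deterministic p p′
    with refl ← ⇓-deterministic q q′ = refl
  ⇓-deterministic (⇓call p q) (⇓call p′ q′)
    with refl ← ⇓-deterministic p p′
    with refl ← ⇓-deterministic q q′ = refl

_On_Returns_InTime_ : Program → Tree → Tree → ℕ → Set
P On a Returns v InTime t = _⊢_⇓_⟨_⟩ (body P) (a ∷ []) (main P) v t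

------------------------------------------------------------------------
-- Input and output

encodeBool : Bool → Tree
encodeBool false = nil
encodeBool true  = nil ∙ nil

encodeList : ∀ {n} → (Fin n → Tree) → Tree
encodeList = Vector.foldr _∙_ nil

-- The adjacency matrix, as a list of rows. Neither the neighborhood
-- diversity nor a twin partition is part of the input.
encodeGraph : ∀ {n} → Graph n → Tree
encodeGraph G = encodeList λ u → encodeList λ v → encodeBool (adj G u v)

encodePlayer : Player → Tree
encodePlayer first  = encodeBool true
encodePlayer second = encodeBool false

------------------------------------------------------------------------
-- Rational bounds

fromℕ : ℕ → ℚ
fromℕ m = + m ℚ./ 1

-- (n/ν + 1)^ν. Only the graph without vertices has neighborhood diversity 0;
-- n/ν is then undefined.
bound : (n ν : ℕ) .{{_ : NonZero ν}} → ℚ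
bound n ν = ((+ n ℚ./ ν) ℚ.+ 1ℚ) ℚ-Power.^ ν

{-# OPTIONS --safe #-}

-- Twins are interchangeable, so only the vertex sets that contain, with every vertex,
-- all its earlier twins have to be considered as positions. A class of m twins meets
-- such a set in one of m + 1 ways; by the inequality of arithmetic and geometric means
-- there are at most (n/ν + 1)^ν of these sets. The algorithm keeps the lost positions in
-- a binary trie and recomputes it n times; the r-th trie is correct for the sets with
-- fewer than r elements. A move to a set outside the trie needs no special care:
-- exchanging a removed vertex for a later twin turns it into an equivalent move, and
-- repeating this leads to a set in the trie.
module Submission where

open import Defs
open import Algebra.Bundles using (CommutativeRing)
open import Data.Bool.Base using (Bool; true; false; _∧_; _∨_; not; if_then_else_; T)
open import Data.Bool.Properties as Bool using (∧-comm)
open import Data.Fin using (#_)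
open import Data.Fin.Base as Fin using (Fin; zero; suc; toℕ)
open import Data.Fin.Properties as Fin using (_≟_; any?; toℕ<n; suc-injective)
open import Data.Fin.Subset using (Subset; _-_; ∣_∣)
open import Data.Fin.Subset.Properties using (∣p∣≤n; p─⊥≡p)
import Data.Integer.Base as ℤ
import Data.Integer.Properties as ℤ
import Data.Integer.Tactic.RingSolver as ℤ-Solver
open import Data.List.Base as List using (List; []; _∷_; _++_)
import Data.List.Properties as List
open import Data.Nat.Base
open import Data.Nat.Properties hiding (_≟_; suc-injective)
open import Data.Nat.Tactic.RingSolver using (solve-∀)
open import Data.Product.Base using (_×_; _,_; ∃-syntax; proj₁; proj₂)
open import Data.Rational.Base as ℚ using (1ℚ; toℚᵘ)
  renaming (_*_ to _*ℚ_; _≤_ to _≤ℚ_)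
import Data.Rational.Properties as ℚ
open import Data.Rational.Unnormalised.Base as ℚᵘ using (mkℚᵘ; *≡*; *≤*)
import Data.Rational.Unnormalised.Properties as ℚᵘ
open import Data.Sum.Base using (_⊎_; inj₁; inj₂)
open import Data.Vec.Base as Vec using (Vec; []; _∷_; lookup; tabulate; toList; _[_]≔_)
open import Data.Vec.Properties as Vec
  using (lookup∘tabulate; lookup-map; lookup-replicate; lookup∘update; lookup∘update′)
open import Function.Base using (_∘_; id)
open import Relation.Binary.PropositionalEquality
open import Relation.Nullary using (¬_; Dec; yes; no; contradiction)
open import Relation.Nullary.Decidable using (True; toWitness; _×-dec_; ⌊_⌋)

open import Algebra.Properties.CommutativeMonoid.Sum +-0-commutativeMonoid
  using (sum; sum-cong-≗; ∑-distrib-+; sum-replicate-zero)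
open import Algebra.Properties.CommutativeMonoid.Sum *-1-commutativeMonoid
  using () renaming (sum to prod; sum-cong-≗ to prod-cong)
open import Algebra.Properties.CommutativeSemiring.Exp
  (CommutativeRing.commutativeSemiring ℚ.+-*-commutativeRing) using (^-distrib-*)
import Algebra.Definitions.RawSemiring ℚ.+-*-rawSemiring as ℚ-Power

-- Tables are immutable trees, so a table under construction would have to be threaded through its
-- own construction before later entries could consult earlier ones. Building each table from the
-- complete previous one avoids this; the factor of about n disappears in the polynomial. One round
-- extends the correct sizes by one because a move strictly shrinks the vertex set. Entries for
-- larger sets may be wrong in the meantime. No twin partition is ever computed: the program only
-- compares pairs of rows. A partition enters the analysis alone, where any twin partition into w
-- parts bounds the number of leaves, so not knowing ν costs nothing. The exchange of a removed
-- vertex for a later twin stops because the removed vertices move towards the end of the vertex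
-- order. The counting bound is proved in ℕ as w^w * leaves ≤ (n + w)^w; the division takes place
-- only in ℚ, at the end.

total : List ℕ → ℕ
total []           = 0
-- Without a trailing 0, the sum over the calls of a body is literally the bound claimed for it, so
-- that `≤-refl` usually proves the estimate.
total (x ∷ [])     = x
total (x ∷ y ∷ xs) = x + total (y ∷ xs)

total-∷ : ∀ x xs → total (x ∷ xs) ≡ x + total xs
total-∷ x []      = sym (+-identityʳ x)
total-∷ x (_ ∷ _) = refl

total-∷ʳ : ∀ xs x → total (xs ++ x ∷ []) ≡ total xs + x
total-∷ʳ []       x = refl
total-∷ʳ (y ∷ xs) x = begin
  total (y ∷ (xs ++ x ∷ []))  ≡⟨ total-∷ y (xs ++ x ∷ []) ⟩
  y + total (xs ++ x ∷ [])    ≡⟨ cong (y +_) (total-∷ʳ xs x) ⟩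
  y + (total xs + x)          ≡⟨ +-assoc y (total xs) x ⟨
  (y + total xs) + x          ≡⟨ cong (_+ x) (total-∷ y xs) ⟨
  total (y ∷ xs) + x          ∎
  where open ≡-Reasoning

-- Weakest preconditions with running times

module Cost {f : ℕ} (bodies : Vec (Exp f 1) f) where

  record Call (g : Fin f) (a v : Tree) (B : ℕ) : Set where
    constructor ⟪_,_⟫
    field
      {time} : ℕ
      eval   : _⊢_⇓_⟨_⟩ bodies (a ∷ []) (lookup bodies g) v time
      time≤  : time ≤ B

  -- A weakest precondition calculus. The time spent so far is split into a
  -- constant k and the list cs of the bounds on the calls made, so that for a
  -- given expression both components evaluate to normal forms.
  Post : Set₁
  Post = Tree → ℕ → List ℕ → Set

  branch : Tree → Set → (Tree → Tree → Set) → Set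
  branch nil     P Q = P
  branch (a ∙ b) P Q = Q a b

  wp : ∀ {m} → Exp f m → Vec Tree m → ℕ → List ℕ → Post → Set
  wp (var x)        ρ k cs Q = Q (lookup ρ x) (suc k) cs
  wp nil            ρ k cs Q = Q nil (suc k) cs
  wp (cons e e₁)    ρ k cs Q =
    wp e ρ (suc k) cs λ a k cs → wp e₁ ρ k cs λ b k cs → Q (a ∙ b) k cs
  wp (case e e₀ e₁) ρ k cs Q =
    wp e ρ (suc k) cs λ v k cs →
      branch v (wp e₀ ρ k cs Q) λ a b → wp e₁ (a ∷ b ∷ ρ) k cs Q
  wp (bind e e₁)    ρ k cs Q =
    wp e ρ (suc k) cs λ a k cs → wp e₁ (a ∷ ρ) k cs Q
  wp (call g e)     ρ k cs Q =
    wp e ρ (suc k) cs λ a k cs →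
      ∃[ v ] ∃[ B ] Call g a v B × Q v k (cs ++ B ∷ [])

  infixr 4 _▸_
  -- Supplies the calls of a body in evaluation order; value and bound of each are read off from its
  -- `Call`.
  _▸_ : ∀ {g a v B} {Q : Tree → ℕ → Set} → Call g a v B → Q v B →
        ∃[ v ] ∃[ B ] Call g a v B × Q v B
  c ▸ q = _ , _ , c , q

  -- The estimate is relative to the time `k + total cs` spent before `e` starts, so that estimates
  -- for successive subexpressions compose.
  record Outcome {m} (e : Exp f m) (ρ : Vec Tree m) (k : ℕ) (cs : List ℕ)
                 (Q : Post) : Set where
    constructor outcome
    field
      {value}  : Tree
      {time k′} : ℕ
      {cs′}    : List ℕ
      eval     : _⊢_⇓_⟨_⟩ bodies ρ e value time
      time≤    : time + (k + total cs) ≤ k′ + total cs′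
      post     : Q value k′ cs′

  private
    chain : ∀ s t {x y z} → s + suc x ≤ y → t + y ≤ z → suc (s + t) + x ≤ z
    chain s t {x} {y} {z} p q = begin
      suc (s + t) + x  ≡⟨ cong (λ w → suc (w + x)) (+-comm s t) ⟩
      suc (t + s) + x  ≡⟨ cong suc (+-assoc t s x) ⟩
      suc (t + (s + x))  ≡⟨ +-suc t (s + x) ⟨
      t + suc (s + x)  ≡⟨ cong (t +_) (+-suc s x) ⟨
      t + (s + suc x)  ≤⟨ +-monoʳ-≤ t p ⟩
      t + y            ≤⟨ q ⟩
      z                ∎
      where open ≤-Reasoning

  wp-sound : ∀ {m} (e : Exp f m) ρ k cs Q → wp e ρ k cs Q → Outcome e ρ k cs Q
  wp-sound (var x) ρ k cs Q q = outcome ⇓var ≤-refl q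
  wp-sound nil     ρ k cs Q q = outcome ⇓nil ≤-refl q
  wp-sound (cons e e₁) ρ k cs Q q
    with outcome {time = s} d p q′ ← wp-sound e ρ (suc k) cs _ q
    with outcome {time = t} d′ p′ q″ ← wp-sound e₁ ρ _ _ _ q′
    = outcome (⇓cons d d′) (chain s t p p′) q″
  wp-sound (case e e₀ e₁) ρ k cs Q q
    with wp-sound e ρ (suc k) cs _ q
  ... | outcome {value = nil} {time = s} d p q′
    with outcome {time = t} d′ p′ q″ ← wp-sound e₀ ρ _ _ _ q′
    = outcome (⇓case₀ d d′) (chain s t p p′) q″
  wp-sound (case e e₀ e₁) ρ k cs Q q
      | outcome {value = a ∙ b} {time = s} d p q′
    with outcome {time = t} d′ p′ q″ ← wp-sound e₁ (a ∷ b ∷ ρ) _ _ _ q′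
    = outcome (⇓case₁ d d′) (chain s t p p′) q″
  wp-sound (bind e e₁) ρ k cs Q q
    with outcome {time = s} d p q′ ← wp-sound e ρ (suc k) cs _ q
    with outcome {time = t} d′ p′ q″ ← wp-sound e₁ _ _ _ _ q′
    = outcome (⇓bind d d′) (chain s t p p′) q″
  wp-sound (call g e) ρ k cs Q q
    with outcome {time = s} {k′} {cs′} d p (v , B , ⟪_,_⟫ {t} d′ t≤B , q′)
      ← wp-sound e ρ (suc k) cs _ q
    = outcome (⇓call d d′) (chain s t p bound′) q′
    where
    open ≤-Reasoning
    bound′ : t + (k′ + total cs′) ≤ k′ + total (cs′ ++ B ∷ [])
    bound′ = begin
      t + (k′ + total cs′)         ≡⟨ +-comm t _ ⟩
      (k′ + total cs′) + t         ≤⟨ +-monoʳ-≤ (k′ + total cs′) t≤B ⟩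
      (k′ + total cs′) + B         ≡⟨ +-assoc k′ _ B ⟩
      k′ + (total cs′ + B)         ≡⟨ cong (k′ +_) (total-∷ʳ cs′ B) ⟨
      k′ + total (cs′ ++ B ∷ [])   ∎

  -- For a given body `k` evaluates to a numeral, and the comparison with `K` is settled by
  -- computation. Only the sum of the call bounds is left to prove.
  Returns : Tree → ℕ → ℕ → Post
  Returns v K A v′ k cs = v′ ≡ v × True (k ≤? K) × total cs ≤ A

  verified : ∀ {m} {e : Exp f m} {ρ v} K {A} → wp e ρ 0 [] (Returns v K A) →
             ∃[ t ] (_⊢_⇓_⟨_⟩ bodies ρ e v t × t ≤ K + A)
  verified {e = e} {ρ} K q
    with outcome {time = t} d t≤ (refl , k≤K , cs≤A) ← wp-sound e ρ 0 [] _ q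
    = _ , d , ≤-trans (≤-reflexive (sym (+-identityʳ t)))
                (≤-trans t≤ (+-mono-≤ (toWitness k≤K) cs≤A))

  verify : ∀ {g a v} K {A} → wp (lookup bodies g) (a ∷ []) 0 [] (Returns v K A) →
           Call g a v (K + A)
  verify K q with _ , d , t≤ ← verified K q = ⟪ d , t≤ ⟫

-- The program

pattern setAtᶠ    = zero
pattern markᶠ     = suc setAtᶠ
pattern matchᶠ    = suc markᶠ
pattern mapMatchᶠ = suc matchᶠ
pattern twinsᶠ    = suc mapMatchᶠ
pattern fillᶠ     = suc twinsᶠ
pattern orᶠ       = suc fillᶠ
pattern snocᶠ     = suc orᶠ
pattern lookᶠ     = suc snocᶠ
pattern seekᶠ     = suc lookᶠ
pattern stuckᶠ    = suc seekᶠ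
pattern buildᶠ    = suc stuckᶠ
pattern iterateᶠ  = suc buildᶠ

v : ∀ {m} i {i<m : True (i <? m)} → Exp 13 m
v i {i<m} = var (#_ i {m<n = i<m})

infixr 5 _⊙_
_⊙_ : ∀ {m} → Exp 13 m → Exp 13 m → Exp 13 m
_⊙_ = cons

falseᵉ trueᵉ selfᵉ : ∀ {m} → Exp 13 m
falseᵉ = nil
trueᵉ  = nil ⊙ nil
selfᵉ  = trueᵉ ⊙ nil

-- The default `nil` matters in `child₀ᵉ` and `child₁ᵉ`, where everything below a pruned node stays
-- `nil`, and in `isSelfᵉ`, where the bit false is `nil`.
unpair : ∀ {m} → Exp 13 m → Exp 13 (2 + m) → Exp 13 m
unpair e e₁ = case e nil e₁

isSelfᵉ child₀ᵉ child₁ᵉ : ∀ {m} → Exp 13 m → Exp 13 m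
isSelfᵉ c = unpair c (case (v 0) falseᵉ trueᵉ)
child₀ᵉ t = unpair t (v 0)
child₁ᵉ t = unpair t (v 1)

setAtᵇ markᵇ matchᵇ mapMatchᵇ twinsᵇ fillᵇ orᵇ snocᵇ lookᵇ seekᵇ stuckᵇ buildᵇ iterateᵇ
  : Exp 13 1

setAtᵇ =
  unpair (v 0)
    (case (v 1) nil
      (case (v 2) (selfᵉ ⊙ v 1)
        (v 2 ⊙ call setAtᶠ (v 1 ⊙ v 3))))

markᵇ =
  unpair (v 0)
    (case (v 1) nil
      (call setAtᶠ (v 2 ⊙ v 0) ⊙ call markᶠ ((nil ⊙ v 2) ⊙ v 1)))

matchᵇ =
  unpair (v 0)
    (case (v 0) trueᵉ
      (case (v 3) trueᵉ
        (case (case (v 2)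
                (case (v 0) trueᵉ (case (v 0) falseᵉ trueᵉ))
                (case (v 0) (case (v 2) falseᵉ trueᵉ) trueᵉ))
          falseᵉ
          (call matchᶠ (v 5 ⊙ v 3)))))

mapMatchᵇ =
  unpair (v 0)
    (case (v 1) nil
      (call matchᶠ (v 2 ⊙ v 0) ⊙ call mapMatchᶠ (v 2 ⊙ v 1)))

twinsᵇ =
  case (v 0) nil
    (call mapMatchᶠ (v 0 ⊙ v 1) ⊙ call twinsᶠ (v 1))

fillᵇ =
  unpair (v 0)
    (case (v 1) nil
      (v 2 ⊙ call fillᶠ (v 2 ⊙ v 1)))

orᵇ =
  unpair (v 0)
    (case (v 0) nil
      (unpair (v 3)
        (case (v 2) (v 0) trueᵉ ⊙ call orᶠ (v 3 ⊙ v 1))))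

snocᵇ =
  unpair (v 0)
    (case (v 0) (v 1 ⊙ nil)
      (v 0 ⊙ call snocᶠ (v 1 ⊙ v 3)))

lookᵇ =
  unpair (v 0)
    (unpair (v 1)
      (case (v 1) (v 2)
        (unpair (v 2)
          (case (isSelfᵉ (v 2))
            (call lookᶠ (case (v 0) (child₀ᵉ (v 6)) (child₁ᵉ (v 8)) ⊙ v 1 ⊙ v 3))
            (case (v 2) nil
              (call lookᶠ (child₀ᵉ (v 10) ⊙ v 5 ⊙ v 7)))))))

seekᵇ =
  unpair (v 0)
    (unpair (v 1)
      (case (v 1) nil
        (unpair (v 2)
          (case (isSelfᵉ (v 2))
            (case (call seekᶠ (case (v 0) (child₀ᵉ (v 6)) (child₁ᵉ (v 8)) ⊙ v 1 ⊙ v 3))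
              (case (v 2) nil
                (case (v 2) nil
                  (call lookᶠ (child₀ᵉ (v 10) ⊙ v 5 ⊙ v 7))))
              trueᵉ)
            (case (v 2) nil
              (call seekᶠ (child₀ᵉ (v 10) ⊙ v 5 ⊙ v 7)))))))

stuckᵇ =
  unpair (v 0)
    (unpair (v 1)
      (case (v 1) trueᵉ
        (case (call seekᶠ (v 4 ⊙ v 2 ⊙ v 0))
          (call stuckᶠ (v 4 ⊙ v 2 ⊙ v 1))
          falseᵉ)))

buildᵇ =
  unpair (v 0)
    (unpair (v 1)
      (unpair (v 1)
        (case (v 0)
          (unpair (v 4) (call stuckᶠ (v 0 ⊙ v 4 ⊙ v 1)))
          (unpair (v 3)
            (call buildᶠ (v 8 ⊙ call snocᶠ (v 6 ⊙ falseᵉ) ⊙ v 3 ⊙ call orᶠ (v 1 ⊙ v 2))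
             ⊙ case (v 0)
                 (call buildᶠ (v 8 ⊙ call snocᶠ (v 6 ⊙ trueᵉ) ⊙ v 3 ⊙ v 1))
                 nil)))))

-- The argument is counter ∙ rows ∙ twins ∙ mask ∙ table; the counter is a list, read in unary.
iterateᵇ =
  unpair (v 0)
    (case (v 0)
      (unpair (v 1) (unpair (v 1) (unpair (v 1) (v 1))))
      (unpair (v 3) (unpair (v 1) (unpair (v 1)
        (call iterateᶠ (v 7 ⊙ v 4 ⊙ v 2 ⊙ v 0 ⊙
          call buildᶠ ((v 1 ⊙ v 4) ⊙ nil ⊙ v 2 ⊙ v 0)))))))

solver : Program
solver = record
  { functions = 13
  ; body = setAtᵇ ∷ markᵇ ∷ matchᵇ ∷ mapMatchᵇ ∷ twinsᵇ ∷ fillᵇ ∷ orᵇ ∷ snocᵇ ∷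
           lookᵇ ∷ seekᵇ ∷ stuckᵇ ∷ buildᵇ ∷ iterateᵇ ∷ []
  ; main =
      bind (call markᶠ (nil ⊙ v 0))
        (bind (call twinsᶠ (v 0))
          -- The input graph doubles as the unary counter, since it has n rows. The final `nil` is
          -- the table of round 0, which contains no lost position.
          (bind (call iterateᶠ (v 2 ⊙ v 1 ⊙ v 0 ⊙ call fillᶠ (falseᵉ ⊙ v 2) ⊙ nil))
            -- The answer `nil` means that some move reaches a lost position; then the first player
            -- wins, who is encoded as true.
            (case (call stuckᶠ (v 0 ⊙ call fillᶠ (trueᵉ ⊙ v 3) ⊙ v 2))
              trueᵉ
              falseᵉ)))
  }

open Cost (body solver)

-- Its functions on typed data

-- A row of the adjacency matrix has `self` on the diagonal. As `self` agrees with every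
-- cell, two rows match exactly if their vertices are twins.
data Cell : Set where
  bit  : Bool → Cell
  self : Cell

Row : ℕ → Set
Row = Vec Cell

data Triangle : ℕ → Set where
  []  : Triangle 0
  _∷_ : ∀ {n} → Vec Bool n → Triangle n → Triangle (suc n)

setAt : ∀ {n} → ℕ → Row n → Row n
setAt c       []       = []
setAt zero    (x ∷ xs) = self ∷ xs
setAt (suc c) (x ∷ xs) = x ∷ setAt c xs

mark : ∀ {n m} → ℕ → Vec (Row n) m → Vec (Row n) m
mark c []       = []
mark c (r ∷ rs) = setAt c r ∷ mark (suc c) rs

agree : Cell → Cell → Bool
agree (bit false) (bit b) = not b
agree (bit true)  (bit b) = b
agree (bit _)     self    = true
agree self        _       = true

match : ∀ {n} → Row n → Row n → Bool
match []       []       = true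
match (a ∷ as) (b ∷ bs) = if agree a b then match as bs else false

twins : ∀ {n m} → Vec (Row n) m → Triangle m
twins []       = []
twins (r ∷ rs) = Vec.map (match r) rs ∷ twins rs

orVec : ∀ {n} → Vec Bool n → Vec Bool n → Vec Bool n
orVec = Vec.zipWith _∨_

-- A table is a binary trie, which branches at level i on the membership of vertex i.
-- The positions lost for the player to move are its non-nil leaves.
child : Bool → Tree → Tree
child b     nil     = nil
child false (s ∙ t) = s
child true  (s ∙ t) = t

entry : ∀ {n} → Tree → Vec Bool n → Tree
entry t []      = t
entry t (b ∷ s) = entry (child b t) s

-- The entry of `s` without the diagonal vertex of the row, or `nil` if `s` lacks that vertex. The
-- adjacency bits are ignored: the row only tells which vertex to remove.
look : ∀ {n} → Tree → Vec Bool n → Row n → Tree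
look t []          []           = t
look t (b ∷ s)     (bit _ ∷ r)  = look (child b t) s r
look t (false ∷ s) (self ∷ r)   = nil
look t (true ∷ s)  (self ∷ r)   = look (child false t) s r

orElse : Tree → Tree → Tree
orElse nil     t = t
orElse (_ ∙ _) t = nil ∙ nil

-- Searches for a neighbour w in `s` of the diagonal vertex u such that the table contains s - u -
-- w. A single descent removes u and starts one `look` at each candidate w, hence the quadratic
-- cost. The diagonal may come before or after w, so both functions handle it.
seek : ∀ {n} → Tree → Vec Bool n → Row n → Tree
seek t []          []               = nil
seek t (false ∷ s) (bit a ∷ r)      = orElse (seek (child false t) s r) nil
seek t (true ∷ s)  (bit false ∷ r)  = orElse (seek (child true t) s r) nil
seek t (true ∷ s)  (bit true ∷ r)   = orElse (seek (child true t) s r) (look (child false t) s r)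
seek t (false ∷ s) (self ∷ r)       = nil
seek t (true ∷ s)  (self ∷ r)       = seek (child false t) s r

isPair : Tree → Bool
isPair nil     = false
isPair (_ ∙ _) = true

-- Backward induction: a position is lost exactly if no move from it reaches a lost position. The
-- lost positions are those recorded in the table.
stuck : ∀ {n m} → Tree → Vec Bool n → Vec (Row n) m → Bool
stuck t s []       = true
stuck t s (r ∷ rs) = if isPair (seek t s r) then false else stuck t s rs

-- The mask marks the vertices that have an earlier twin outside the set.
build : ∀ {n} → (Vec Bool n → Bool) → Triangle n → Vec Bool n → Tree
build f []       []      = encodeBool (f [])
build f (t ∷ tw) (b ∷ mask) =
  build (λ s → f (false ∷ s)) tw (orVec mask t)
  ∙ (if b then nil else build (λ s → f (true ∷ s)) tw mask)

table : ∀ {n} → ℕ → Vec (Row n) n → Tree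
table zero    rows = nil
table (suc r) rows =
  build (λ s → stuck (table r rows) s rows) (twins rows) (Vec.replicate _ false)

encList : {A : Set} → (A → Tree) → List A → Tree
encList enc []       = nil
encList enc (x ∷ xs) = enc x ∙ encList enc xs

encVec : {A : Set} {n : ℕ} → (A → Tree) → Vec A n → Tree
encVec enc xs = encList enc (toList xs)

-- Two case distinctions separate the three cells: false is `nil`, true is a pair with head `nil`,
-- and `self` is a pair whose head is a pair.
encCell : Cell → Tree
encCell (bit b) = encodeBool b
encCell self    = (nil ∙ nil) ∙ nil

encBits : List Bool → Tree
encBits = encList encodeBool

encSet : ∀ {n} → Vec Bool n → Tree
encSet = encVec encodeBool

encRow : ∀ {n} → Row n → Tree
encRow = encVec encCell

encRows : ∀ {n m} → Vec (Row n) m → Tree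
encRows = encVec encRow

encTriangle : ∀ {n} → Triangle n → Tree
encTriangle []       = nil
encTriangle (t ∷ tw) = encSet t ∙ encTriangle tw

encℕ : ℕ → Tree
encℕ zero    = nil
encℕ (suc c) = nil ∙ encℕ c

-- Cost of the functions

-- At least the number of evaluation steps of each body outside its calls.
K : ℕ
K = 60

linear : ℕ → ℕ
linear n = suc n * K

setAt-runs : ∀ {n} c (r : Row n) → Call setAtᶠ (encℕ c ∙ encRow r) (encRow (setAt c r)) (linear n)
setAt-runs zero    []      = verify K (refl , _ , z≤n)
setAt-runs (suc c) []      = verify K (refl , _ , z≤n)
setAt-runs zero    (x ∷ r) = verify K (refl , _ , z≤n)
setAt-runs (suc c) (x ∷ r) = verify K (setAt-runs c r ▸ refl , _ , ≤-refl)

rowwise : ℕ → ℕ → ℕ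
rowwise m n = suc m * (K + linear n)

mark-runs : ∀ {m n} c (rs : Vec (Row n) m) →
    Call markᶠ (encℕ c ∙ encRows rs) (encRows (mark c rs)) (rowwise m n)
mark-runs c []       = verify K (refl , _ , z≤n)
mark-runs c (r ∷ rs) = verify K (setAt-runs c r ▸ mark-runs (suc c) rs ▸ refl , _ , ≤-refl)

match-runs : ∀ {n} (r s : Row n) →
    Call matchᶠ (encRow r ∙ encRow s) (encodeBool (match r s)) (linear n)
match-runs []              []              = verify K (refl , _ , z≤n)
match-runs (bit false ∷ r) (bit false ∷ s) = verify K (match-runs r s ▸ refl , _ , ≤-refl)
match-runs (bit false ∷ r) (bit true ∷ s)  = verify K (refl , _ , z≤n)
match-runs (bit false ∷ r) (self ∷ s)      = verify K (match-runs r s ▸ refl , _ , ≤-refl)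
match-runs (bit true ∷ r)  (bit false ∷ s) = verify K (refl , _ , z≤n)
match-runs (bit true ∷ r)  (bit true ∷ s)  = verify K (match-runs r s ▸ refl , _ , ≤-refl)
match-runs (bit true ∷ r)  (self ∷ s)      = verify K (match-runs r s ▸ refl , _ , ≤-refl)
match-runs (self ∷ r)      (bit false ∷ s) = verify K (match-runs r s ▸ refl , _ , ≤-refl)
match-runs (self ∷ r)      (bit true ∷ s)  = verify K (match-runs r s ▸ refl , _ , ≤-refl)
match-runs (self ∷ r)      (self ∷ s)      = verify K (match-runs r s ▸ refl , _ , ≤-refl)

mapMatch-runs : ∀ {m n} (r : Row n) (rs : Vec (Row n) m) →
  Call mapMatchᶠ (encRow r ∙ encRows rs) (encSet (Vec.map (match r) rs)) (rowwise m n)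
mapMatch-runs r []       = verify K (refl , _ , z≤n)
mapMatch-runs r (s ∷ rs) = verify K (match-runs r s ▸ mapMatch-runs r rs ▸ refl , _ , ≤-refl)

twinsCost : ℕ → ℕ → ℕ
twinsCost zero    n = K
twinsCost (suc m) n = K + (rowwise m n + twinsCost m n)

twins-runs : ∀ {m n} (rs : Vec (Row n) m) →
    Call twinsᶠ (encRows rs) (encTriangle (twins rs)) (twinsCost m n)
twins-runs []       = verify K {0} (refl , _ , z≤n)
twins-runs (r ∷ rs) = verify K (mapMatch-runs r rs ▸ twins-runs rs ▸ refl , _ , ≤-refl)

fill-runs : ∀ {m} {A : Set} b (enc : A → Tree) (rs : Vec A m) →
  Call fillᶠ (encodeBool b ∙ encVec enc rs) (encSet (Vec.replicate m b)) (linear m)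
fill-runs b enc []       = verify K (refl , _ , z≤n)
fill-runs b enc (r ∷ rs) = verify K (fill-runs b enc rs ▸ refl , _ , ≤-refl)

or-runs : ∀ {n} (p q : Vec Bool n) → Call orᶠ (encSet p ∙ encSet q) (encSet (orVec p q)) (linear n)
or-runs []          []      = verify K (refl , _ , z≤n)
or-runs (false ∷ p) (b ∷ q) = verify K (or-runs p q ▸ refl , _ , ≤-refl)
or-runs (true ∷ p)  (b ∷ q) = verify K (or-runs p q ▸ refl , _ , ≤-refl)

snoc-runs : ∀ p b → Call snocᶠ (encBits p ∙ encodeBool b) (encBits (p ++ b ∷ []))
    (linear (List.length p))
snoc-runs []      b = verify K (refl , _ , z≤n)
snoc-runs (a ∷ p) b = verify K (snoc-runs p b ▸ refl , _ , ≤-refl)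

look-runs : ∀ {n} t (s : Vec Bool n) (r : Row n) →
  Call lookᶠ (t ∙ encSet s ∙ encRow r) (look t s r) (linear n)
look-runs t       []          []              = verify K (refl , _ , z≤n)
look-runs nil     (false ∷ s) (bit false ∷ r) = verify K (look-runs nil s r ▸ refl , _ , ≤-refl)
look-runs nil     (false ∷ s) (bit true ∷ r)  = verify K (look-runs nil s r ▸ refl , _ , ≤-refl)
look-runs nil     (true ∷ s)  (bit false ∷ r) = verify K (look-runs nil s r ▸ refl , _ , ≤-refl)
look-runs nil     (true ∷ s)  (bit true ∷ r)  = verify K (look-runs nil s r ▸ refl , _ , ≤-refl)
look-runs (a ∙ b) (false ∷ s) (bit false ∷ r) = verify K (look-runs a s r ▸ refl , _ , ≤-refl)
look-runs (a ∙ b) (false ∷ s) (bit true ∷ r)  = verify K (look-runs a s r ▸ refl , _ , ≤-refl)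
look-runs (a ∙ b) (true ∷ s)  (bit false ∷ r) = verify K (look-runs b s r ▸ refl , _ , ≤-refl)
look-runs (a ∙ b) (true ∷ s)  (bit true ∷ r)  = verify K (look-runs b s r ▸ refl , _ , ≤-refl)
look-runs t       (false ∷ s) (self ∷ r)      = verify K (refl , _ , z≤n)
look-runs nil     (true ∷ s)  (self ∷ r)      = verify K (look-runs nil s r ▸ refl , _ , ≤-refl)
look-runs (a ∙ b) (true ∷ s)  (self ∷ r)      = verify K (look-runs a s r ▸ refl , _ , ≤-refl)

seekCost : ℕ → ℕ
seekCost zero    = K
seekCost (suc n) = K + (seekCost n + linear n)

seek-runs : ∀ {n} t (s : Vec Bool n) (r : Row n) →
  Call seekᶠ (t ∙ encSet s ∙ encRow r) (seek t s r) (seekCost n)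
seek-runs t [] [] = verify K {0} (refl , _ , z≤n)
seek-runs t (false ∷ s) (self ∷ r) = verify K (refl , _ , z≤n)
seek-runs nil (true ∷ s) (self ∷ r) = verify K (seek-runs nil s r ▸ refl , _ , m≤m+n _ _)
seek-runs (a ∙ b) (true ∷ s) (self ∷ r) = verify K (seek-runs a s r ▸ refl , _ , m≤m+n _ _)
-- The body branches on the result of the recursive call, so this result must be split before the
-- precondition can evaluate further.
seek-runs nil (false ∷ s) (bit false ∷ r) with seek nil s r | seek-runs nil s r
... | nil   | c = verify K (c ▸ refl , _ , m≤m+n _ _)
... | _ ∙ _ | c = verify K (c ▸ refl , _ , m≤m+n _ _)
seek-runs nil (false ∷ s) (bit true ∷ r) with seek nil s r | seek-runs nil s r
... | nil   | c = verify K (c ▸ refl , _ , m≤m+n _ _)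
... | _ ∙ _ | c = verify K (c ▸ refl , _ , m≤m+n _ _)
seek-runs nil (true ∷ s) (bit false ∷ r) with seek nil s r | seek-runs nil s r
... | nil   | c = verify K (c ▸ refl , _ , m≤m+n _ _)
... | _ ∙ _ | c = verify K (c ▸ refl , _ , m≤m+n _ _)
seek-runs nil (true ∷ s) (bit true ∷ r) with seek nil s r | seek-runs nil s r
... | nil   | c = verify K (c ▸ look-runs nil s r ▸ refl , _ , ≤-refl)
... | _ ∙ _ | c = verify K (c ▸ refl , _ , m≤m+n _ _)
seek-runs (a ∙ b) (false ∷ s) (bit false ∷ r) with seek a s r | seek-runs a s r
... | nil   | c = verify K (c ▸ refl , _ , m≤m+n _ _)
... | _ ∙ _ | c = verify K (c ▸ refl , _ , m≤m+n _ _)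
seek-runs (a ∙ b) (false ∷ s) (bit true ∷ r) with seek a s r | seek-runs a s r
... | nil   | c = verify K (c ▸ refl , _ , m≤m+n _ _)
... | _ ∙ _ | c = verify K (c ▸ refl , _ , m≤m+n _ _)
seek-runs (a ∙ b) (true ∷ s) (bit false ∷ r) with seek b s r | seek-runs b s r
... | nil   | c = verify K (c ▸ refl , _ , m≤m+n _ _)
... | _ ∙ _ | c = verify K (c ▸ refl , _ , m≤m+n _ _)
seek-runs (a ∙ b) (true ∷ s) (bit true ∷ r) with seek b s r | seek-runs b s r
... | nil   | c = verify K (c ▸ look-runs a s r ▸ refl , _ , ≤-refl)
... | _ ∙ _ | c = verify K (c ▸ refl , _ , m≤m+n _ _)

stuckCost : ℕ → ℕ → ℕ
stuckCost m n = suc m * (K + seekCost n)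

stuck-runs : ∀ {m n} t (s : Vec Bool n) (rs : Vec (Row n) m) →
  Call stuckᶠ (t ∙ encSet s ∙ encRows rs) (encodeBool (stuck t s rs)) (stuckCost m n)
stuck-runs t s [] = verify K (refl , _ , z≤n)
stuck-runs t s (r ∷ rs) with seek t s r | seek-runs t s r
... | nil   | c = verify K (c ▸ stuck-runs t s rs ▸ refl , _ , ≤-refl)
... | _ ∙ _ | c = verify K (c ▸ refl , _ , m≤m+n _ _)

-- n bounds the length of the prefixes, and l is the cost of a leaf.
buildCost : ∀ {m} → ℕ → ℕ → Triangle m → Vec Bool m → ℕ
buildCost n l []       []         = K + l
buildCost n l (t ∷ tw) (b ∷ mask) =
  -- Three linear calls per node: two extensions of the prefix by `snocᶠ` and one update of the mask
  -- by `orᶠ`.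
  K + (3 * linear n + (buildCost n l tw (orVec mask t) + (if b then 0 else buildCost n l tw mask)))

linear-mono : ∀ m n → m ≤ n → linear m ≤ linear n
linear-mono m n m≤n = *-monoˡ-≤ K (s≤s m≤n)

private
  calls≤ : ∀ {a o X} (b c : ℕ) → a ≤ X → o ≤ X → a + (o + (b + (a + c))) ≤ 3 * X + (b + c)
  calls≤ {a} {o} {X} b c p q = begin
    a + (o + (b + (a + c)))  ≤⟨ +-mono-≤ p (+-mono-≤ q (+-monoʳ-≤ b (+-monoˡ-≤ c p))) ⟩
    X + (X + (b + (X + c)))  ≡⟨ rearrange X b c ⟩
    3 * X + (b + c)          ∎
    where
    open ≤-Reasoning
    rearrange : ∀ X b c → X + (X + (b + (X + c))) ≡ 3 * X + (b + c)
    rearrange = solve-∀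

  calls≤′ : ∀ {a o X} (b : ℕ) → a ≤ X → o ≤ X → a + (o + b) ≤ 3 * X + (b + 0)
  calls≤′ {a} {o} b p q = ≤-trans (+-monoʳ-≤ a (+-monoʳ-≤ o (m≤m+n b (a + 0)))) (calls≤ b 0 p q)

-- The program carries the prefix `p` of memberships already decided, whereas `build` carries a
-- function `f` of those still open. The last hypothesis ties them together: `stuckᶠ` on the
-- completed set computes `f`.
build-runs : ∀ {m} {t rows l} n p (f : Vec Bool m → Bool) (tw : Triangle m) (mask : Vec Bool m) →
  List.length p + m ≤ n →
  (∀ s → Call stuckᶠ (t ∙ encBits (p ++ toList s) ∙ rows) (encodeBool (f s)) l) →
  Call buildᶠ ((t ∙ rows) ∙ encBits p ∙ encTriangle tw ∙ encSet mask)
       (build f tw mask) (buildCost n l tw mask)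
build-runs {t = t} {rows} {l} n p f [] [] _ H =
  verify K (subst (λ q → Call stuckᶠ (t ∙ encBits q ∙ rows) (encodeBool (f [])) l)
              (List.++-identityʳ p) (H [])
            ▸ refl , _ , ≤-refl)
build-runs {suc m} {t} {rows} {l} n p f (ts ∷ tw) (b ∷ mask) le H = go b
  where
  extended : ∀ c s → Call stuckᶠ (t ∙ encBits ((p ++ c ∷ []) ++ toList s) ∙ rows)
                                 (encodeBool (f (c ∷ s))) l
  extended c s = subst (λ q → Call stuckᶠ (t ∙ encBits q ∙ rows) (encodeBool (f (c ∷ s))) l)
                   (sym (List.++-assoc p (c ∷ []) (toList s))) (H (c ∷ s))
  le′ : ∀ c → List.length (p ++ c ∷ []) + m ≤ n
  le′ c = ≤-trans (≤-reflexive (trans (cong (_+ m) (trans (List.length-++ p) (+-comm _ 1)))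
                     (sym (+-suc (List.length p) m)))) le
  lp : linear (List.length p) ≤ linear n
  lp = linear-mono (List.length p) n (≤-trans (m≤m+n (List.length p) (suc m)) le)
  lm : linear m ≤ linear n
  lm = linear-mono m n (≤-trans (≤-trans (n≤1+n m) (m≤n+m (suc m) (List.length p))) le)
  exclude = build-runs n (p ++ false ∷ []) (λ s → f (false ∷ s)) tw (orVec mask ts)
    (le′ false) (extended false)
  include = build-runs n (p ++ true ∷ []) (λ s → f (true ∷ s)) tw mask (le′ true) (extended true)
  go : ∀ b → Call buildᶠ ((t ∙ rows) ∙ encBits p ∙ encTriangle (ts ∷ tw) ∙ encSet (b ∷ mask))
       (build f (ts ∷ tw) (b ∷ mask)) (buildCost n l (ts ∷ tw) (b ∷ mask))
  go true  = verify K (snoc-runs p false ▸ or-runs mask ts ▸ exclude ▸ refl , _ , 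
    calls≤′ (buildCost n l tw (orVec mask ts)) lp lm)
  go false = verify K (snoc-runs p false ▸ or-runs mask ts ▸ exclude ▸ snoc-runs p true ▸ include
      ▸ refl , _ ,
    calls≤ (buildCost n l tw (orVec mask ts)) (buildCost n l tw mask) lp lm)

none all : ∀ {n} → Vec Bool n
none = Vec.replicate _ false
all = Vec.replicate _ true

roundCost : ∀ {n} → Vec (Row n) n → ℕ
roundCost {n} rows = buildCost n (stuckCost n n) (twins rows) none

iterateCost : ∀ {n} → ℕ → Vec (Row n) n → ℕ
iterateCost k rows = suc k * (K + roundCost rows)

iterateInput : ∀ {n} → Tree → Vec (Row n) n → Tree → Tree
iterateInput {n} counter rows t =
  counter ∙ encRows rows ∙ encTriangle (twins rows) ∙ encSet (none {n}) ∙ t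

iterate-runs : ∀ {n k} {A : Set} (enc : A → Tree) (counter : Vec A k) (rows : Vec (Row n) n) r →
  Call iterateᶠ (iterateInput (encVec enc counter) rows (table r rows))
    (table (k + r) rows) (iterateCost k rows)
iterate-runs enc [] rows r = verify K (refl , _ , z≤n)
iterate-runs {k = suc k} enc (_ ∷ counter) rows r =
  verify K (build-runs _ [] _ (twins rows) none ≤-refl (λ s → stuck-runs (table r rows) s rows)
    ▸ subst (λ j → Call iterateᶠ (iterateInput (encVec enc counter) rows (table (suc r) rows))
                     (table j rows) (iterateCost k rows))
        (+-suc k r) (iterate-runs enc counter rows (suc r))
    ▸ refl , _ , ≤-refl)

-- The complete run of the program

rawRows markedRows : ∀ {n} → Graph n → Vec (Row n) n
rawRows G = Vec.tabulate λ u → Vec.tabulate λ w → bit (adj G u w)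
markedRows G = mark 0 (rawRows G)

encodeList≡encVec : ∀ {A : Set} {n} (enc : A → Tree) (f : Fin n → A) {g} → (∀ i → g i ≡ enc (f i)) →
                    encodeList g ≡ encVec enc (Vec.tabulate f)
encodeList≡encVec {n = zero}  enc f g≗ = refl
encodeList≡encVec {n = suc n} enc f g≗ =
    cong₂ _∙_ (g≗ zero) (encodeList≡encVec enc (λ i → f (suc i)) (λ i → g≗ (suc i)))

encodeGraph≡ : ∀ {n} (G : Graph n) → encodeGraph G ≡ encRows (rawRows G)
encodeGraph≡ G = encodeList≡encVec encRow _ λ u → encodeList≡encVec encCell _ λ w → refl

secondWins : ∀ {n} → Graph n → Bool
secondWins {n} G = stuck (table n (markedRows G)) (all {n}) (markedRows G)

overhead : ℕ → ℕ
overhead n = rowwise n n + (twinsCost n n + (linear n + (linear n + stuckCost n n)))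

solverCost : ∀ {n} → Graph n → ℕ
solverCost {n} G = K + (rowwise n n + (twinsCost n n + (linear n + (iterateCost n (markedRows G) +
  (linear n + stuckCost n n)))))

solver-runs : ∀ {n} (G : Graph n) → ∃[ t ]
  (solver On encodeGraph G Returns encodePlayer (if secondWins G then second else first) InTime t)
  × t ≤ solverCost G
solver-runs {n} G rewrite encodeGraph≡ G = run
  where
  rows = markedRows G
  input = iterateInput (encRows (rawRows G)) rows nil
  iterated : Call iterateᶠ input (table n rows) (iterateCost n rows)
  iterated = subst (λ j → Call iterateᶠ input (table j rows) (iterateCost n rows)) (+-identityʳ n)
    (iterate-runs encRow (rawRows G) rows 0)
  run : ∃[ t ]
    (solver On encRows (rawRows G) Returns encodePlayer (if secondWins G then second else first)
      InTime t)
    × t ≤ solverCost G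
  run with secondWins G | stuck-runs (table n rows) (all {n}) rows
  ... | true  | c = verified K
    (mark-runs 0 (rawRows G) ▸ twins-runs rows ▸ fill-runs false encRow (rawRows G) ▸
     iterated ▸ fill-runs true encRow (rawRows G) ▸ c ▸ refl , _ , ≤-refl)
  ... | false | c = verified K
    (mark-runs 0 (rawRows G) ▸ twins-runs rows ▸ fill-runs false encRow (rawRows G) ▸
     iterated ▸ fill-runs true encRow (rawRows G) ▸ c ▸ refl , _ , ≤-refl)

-- Entries of a table

-- True if `build` does not prune the path of the set. With the empty mask these are the canonical
-- sets.
ok : ∀ {n} → Triangle n → Vec Bool n → Vec Bool n → Bool
ok []       []             []          = true
ok (t ∷ tw) (_ ∷ mask)     (false ∷ s) = ok tw (orVec mask t) s
ok (t ∷ tw) (true ∷ mask)  (true ∷ s)  = false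
ok (t ∷ tw) (false ∷ mask) (true ∷ s)  = ok tw mask s

holds : ∀ {n} → Tree → Vec Bool n → Bool
holds t s = isPair (entry t s)

holds-nil : ∀ {n} (s : Vec Bool n) → holds nil s ≡ false
holds-nil []      = refl
holds-nil (b ∷ s) = holds-nil s

holds-build : ∀ {n} f (tw : Triangle n) mask s → holds (build f tw mask) s ≡ ok tw mask s ∧ f s
holds-build f [] [] [] with f []
... | false = refl
... | true  = refl
holds-build f (t ∷ tw) (b ∷ mask)     (false ∷ s) = holds-build (f ∘ (false ∷_)) tw (orVec mask t) s
holds-build f (t ∷ tw) (true ∷ mask)  (true ∷ s)  = holds-nil s
holds-build f (t ∷ tw) (false ∷ mask) (true ∷ s)  = holds-build (f ∘ (true ∷_)) tw mask s

Canonical : ∀ {n m} → Vec (Row n) m → Vec Bool m → Set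
Canonical rows s = ∀ i j → i Fin.< j → match (lookup rows i) (lookup rows j) ≡ true →
                   lookup s j ≡ true → lookup s i ≡ true

Avoids : ∀ {m} → Vec Bool m → Vec Bool m → Set
Avoids mask s = ∀ i → lookup s i ≡ true → lookup mask i ≡ false

or-false : ∀ {a b} → a ∨ b ≡ false → a ≡ false × b ≡ false
or-false {false} p = refl , p

lookup-orVec : ∀ {n} (p q : Vec Bool n) i → lookup (orVec p q) i ≡ lookup p i ∨ lookup q i
lookup-orVec p q i = Vec.lookup-zipWith _∨_ i p q

private
  true≢false : true ≢ false
  true≢false ()

-- A vertex left out puts its later twins into the mask. So `Avoids` expresses the constraints
-- coming from vertices already passed, and `Canonical` those among the vertices still ahead.
ok-sound : ∀ {n m} (rows : Vec (Row n) m) mask s → ok (twins rows) mask s ≡ true →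
           Avoids mask s × Canonical rows s
ok-sound [] [] [] p = (λ ()) , λ ()
ok-sound (r ∷ rows) (b ∷ mask) (false ∷ s) p
  with avoids , canonical ← ok-sound rows (orVec mask (Vec.map (match r) rows)) s p =
      avoids′ , canonical′
  where
  split : ∀ i → lookup s i ≡ true →
      lookup mask i ≡ false × lookup (Vec.map (match r) rows) i ≡ false
  split i q = or-false (trans (sym (lookup-orVec mask (Vec.map (match r) rows) i)) (avoids i q))
  avoids′ : Avoids (b ∷ mask) (false ∷ s)
  avoids′ (suc i) q = proj₁ (split i q)
  canonical′ : Canonical (r ∷ rows) (false ∷ s)
  canonical′ zero (suc j) _ m q = contradiction
    (trans (sym m) (trans (sym (lookup-map j (match r) rows)) (proj₂ (split j q)))) true≢false
  canonical′ (suc i) (suc j) (s≤s i<j) m q = canonical i j i<j m q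
ok-sound (r ∷ rows) (false ∷ mask) (true ∷ s) p
  with avoids , canonical ← ok-sound rows mask s p = avoids′ , canonical′
  where
  avoids′ : Avoids (false ∷ mask) (true ∷ s)
  avoids′ zero    q = refl
  avoids′ (suc i) q = avoids i q
  canonical′ : Canonical (r ∷ rows) (true ∷ s)
  canonical′ zero    (suc j) _         m q = refl
  canonical′ (suc i) (suc j) (s≤s i<j) m q = canonical i j i<j m q

ok-complete : ∀ {n m} (rows : Vec (Row n) m) mask s → Avoids mask s → Canonical rows s →
              ok (twins rows) mask s ≡ true
ok-complete [] [] [] _ _ = refl
ok-complete (r ∷ rows) (b ∷ mask) (false ∷ s) avoids canonical =
  ok-complete rows _ s avoids′ (λ i j i<j → canonical (suc i) (suc j) (s≤s i<j))
  where
  ts = Vec.map (match r) rows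
  not-twin : ∀ i → lookup s i ≡ true → lookup ts i ≡ false
  not-twin i q with lookup ts i in eq
  ... | false = refl
  ... | true  = contradiction
    (sym (canonical zero (suc i) z<s (trans (sym (lookup-map i (match r) rows)) eq) q)) true≢false
  avoids′ : Avoids (orVec mask ts) s
  avoids′ i q = trans (lookup-orVec mask ts i) (cong₂ _∨_ (avoids (suc i) q) (not-twin i q))
ok-complete (r ∷ rows) (true ∷ mask) (true ∷ s) avoids canonical =
  contradiction (avoids zero refl) true≢false
ok-complete (r ∷ rows) (false ∷ mask) (true ∷ s) avoids canonical =
  ok-complete rows mask s (avoids ∘ suc) (λ i j i<j → canonical (suc i) (suc j) (s≤s i<j))

-- Moves

delete : Cell → Bool → Bool
delete self    _ = false
delete (bit _) b = b

del : ∀ {n} → Row n → Vec Bool n → Vec Bool n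
del = Vec.zipWith delete

-- A marked row has `self` at its own vertex only, so for the row of u this says that u belongs to
-- `s`. Stated in terms of the cells, it survives the recursion past the diagonal.
Contains : ∀ {n} → Vec Bool n → Row n → Set
Contains s r = ∀ u → lookup r u ≡ self → lookup s u ≡ true

look-sound : ∀ {n} t (s : Vec Bool n) r → isPair (look t s r) ≡ true →
             Contains s r × holds t (del r s) ≡ true
look-sound t [] [] p = (λ ()) , p
look-sound t (b ∷ s) (bit _ ∷ r) p with c , h ← look-sound (child b t) s r p =
  (λ { (suc u) → c u }) , h
look-sound t (true ∷ s) (self ∷ r) p with c , h ← look-sound (child false t) s r p =
  (λ { zero _ → refl ; (suc u) → c u }) , h

look-complete : ∀ {n} t (s : Vec Bool n) r → Contains s r → holds t (del r s) ≡ true →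
                isPair (look t s r) ≡ true
look-complete t [] [] c h = h
look-complete t (b ∷ s) (bit _ ∷ r) c h = look-complete (child b t) s r (c ∘ suc) h
look-complete t (false ∷ s) (self ∷ r) c h = contradiction (sym (c zero refl)) true≢false
look-complete t (true ∷ s) (self ∷ r) c h = look-complete (child false t) s r (c ∘ suc) h

Reply : ∀ {n} → Tree → Vec Bool n → Row n → Fin n → Set
Reply t s r w = lookup r w ≡ bit true × lookup s w ≡ true × holds t (del r s [ w ]≔ false) ≡ true

orElse-sound : ∀ a {b} → isPair (orElse a b) ≡ true → isPair a ≡ true ⊎ isPair b ≡ true
orElse-sound nil     p = inj₂ p
orElse-sound (_ ∙ _) p = inj₁ refl

orElse-left : ∀ {a b} → isPair a ≡ true → isPair (orElse a b) ≡ true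
orElse-left {_ ∙ _} p = refl

orElse-right : ∀ a {b} → isPair b ≡ true → isPair (orElse a b) ≡ true
orElse-right nil     p = p
orElse-right (_ ∙ _) p = refl

seek-sound : ∀ {n} t (s : Vec Bool n) r → isPair (seek t s r) ≡ true →
    Contains s r × ∃[ w ] Reply t s r w
seek-sound t [] [] ()
seek-sound t (false ∷ s) (bit a ∷ r) p with inj₁ q ← orElse-sound (seek (child false t) s r) p
  with c , w , rep ← seek-sound (child false t) s r q = (λ { (suc u) → c u }) , suc w , rep
seek-sound t (true ∷ s) (bit false ∷ r) p with inj₁ q ← orElse-sound (seek (child true t) s r) p
  with c , w , rep ← seek-sound (child true t) s r q = (λ { (suc u) → c u }) , suc w , rep
seek-sound t (true ∷ s) (bit true ∷ r) p with orElse-sound (seek (child true t) s r) p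
... | inj₁ q with c , w , rep ← seek-sound (child true t) s r q =
    (λ { (suc u) → c u }) , suc w , rep
... | inj₂ q with c , h ← look-sound (child false t) s r q =
    (λ { (suc u) → c u }) , zero , refl , refl , h
seek-sound t (true ∷ s) (self ∷ r) p with c , w , rep ← seek-sound (child false t) s r p =
  (λ { zero _ → refl ; (suc u) → c u }) , suc w , rep

seek-complete : ∀ {n} t (s : Vec Bool n) r → Contains s r → ∀ w → Reply t s r w →
    isPair (seek t s r) ≡ true
seek-complete t (false ∷ s) (bit a ∷ r) c (suc w) rep =
  orElse-left (seek-complete (child false t) s r (c ∘ suc) w rep)
seek-complete t (true ∷ s) (bit false ∷ r) c (suc w) rep =
  orElse-left (seek-complete (child true t) s r (c ∘ suc) w rep)
seek-complete t (true ∷ s) (bit true ∷ r) c zero (_ , _ , h) =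
  orElse-right (seek (child true t) s r) (look-complete (child false t) s r (c ∘ suc) h)
seek-complete t (true ∷ s) (bit true ∷ r) c (suc w) rep =
  orElse-left (seek-complete (child true t) s r (c ∘ suc) w rep)
seek-complete t (false ∷ s) (self ∷ r) c w rep = contradiction (sym (c zero refl)) true≢false
seek-complete t (true ∷ s) (self ∷ r) c (suc w) rep =
    seek-complete (child false t) s r (c ∘ suc) w rep

stuck-false : ∀ {n m} t (s : Vec Bool n) (rows : Vec (Row n) m) → stuck t s rows ≡ false →
              ∃[ u ] isPair (seek t s (lookup rows u)) ≡ true
stuck-false t s (r ∷ rows) p with isPair (seek t s r) in eq
... | true  = zero , eq
... | false with u , q ← stuck-false t s rows p = suc u , q

stuck-true : ∀ {n m} t (s : Vec Bool n) (rows : Vec (Row n) m) → stuck t s rows ≡ true →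
             ∀ u → isPair (seek t s (lookup rows u)) ≡ false
stuck-true t s (r ∷ rows) p u with isPair (seek t s r) in eq
stuck-true t s (r ∷ rows) p zero    | false = eq
stuck-true t s (r ∷ rows) p (suc u) | false = stuck-true t s rows p u

lookup-mark : ∀ {n m} c (rs : Vec (Row n) m) i →
    lookup (mark c rs) i ≡ setAt (c + toℕ i) (lookup rs i)
lookup-mark c (r ∷ rs) zero    = cong (λ d → setAt d r) (sym (+-identityʳ c))
lookup-mark c (r ∷ rs) (suc i) =
  trans (lookup-mark (suc c) rs i) (cong (λ d → setAt d (lookup rs i)) (sym (+-suc c (toℕ i))))

lookup-setAt : ∀ {n} (u : Fin n) r → lookup (setAt (toℕ u) r) u ≡ self
lookup-setAt zero    (_ ∷ r) = refl
lookup-setAt (suc u) (_ ∷ r) = lookup-setAt u r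

lookup-setAt-≢ : ∀ {n} {u w : Fin n} r → w ≢ u → lookup (setAt (toℕ u) r) w ≡ lookup r w
lookup-setAt-≢ {u = zero}  {zero}  (_ ∷ r) w≢u = contradiction refl w≢u
lookup-setAt-≢ {u = zero}  {suc w} (_ ∷ r) w≢u = refl
lookup-setAt-≢ {u = suc u} {zero}  (_ ∷ r) w≢u = refl
lookup-setAt-≢ {u = suc u} {suc w} (_ ∷ r) w≢u = lookup-setAt-≢ r (w≢u ∘ cong suc)

del-bits : ∀ {n} (f : Fin n → Bool) s → del (tabulate (bit ∘ f)) s ≡ s
del-bits f []      = refl
del-bits f (b ∷ s) = cong (b ∷_) (del-bits (f ∘ suc) s)

del-setAt : ∀ {n} (u : Fin n) (f : Fin n → Bool) s →
            del (setAt (toℕ u) (tabulate (bit ∘ f))) s ≡ s [ u ]≔ false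
del-setAt zero    f (b ∷ s) = cong (false ∷_) (del-bits (f ∘ suc) s)
del-setAt (suc u) f (b ∷ s) = cong (b ∷_) (del-setAt u (f ∘ suc) s)

rem : ∀ {n} → Vec Bool n → Fin n → Fin n → Vec Bool n
rem s u w = (s [ u ]≔ false) [ w ]≔ false

module _ {n} (G : Graph n) where

  row : Fin n → Row n
  row u = lookup (markedRows G) u

  row≡ : ∀ u → row u ≡ setAt (toℕ u) (tabulate (bit ∘ adj G u))
  row≡ u = trans (lookup-mark 0 (rawRows G) u)
      (cong (setAt (toℕ u)) (lookup∘tabulate (λ u → tabulate (bit ∘ adj G u)) u))

  row-self : ∀ u → lookup (row u) u ≡ self
  row-self u = trans (cong (λ r → lookup r u) (row≡ u)) (lookup-setAt u (tabulate (bit ∘ adj G u)))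

  row-bit : ∀ {u w} → w ≢ u → lookup (row u) w ≡ bit (adj G u w)
  row-bit {u} {w} w≢u = trans (cong (λ r → lookup r w) (row≡ u))
    (trans (lookup-setAt-≢ (tabulate (bit ∘ adj G u)) w≢u) (lookup∘tabulate (bit ∘ adj G u) w))

  del-row : ∀ u s → del (row u) s ≡ s [ u ]≔ false
  del-row u s = trans (cong (λ r → del r s) (row≡ u)) (del-setAt u (adj G u) s)

  adj⇒≢ : ∀ {u w} → adj G u w ≡ true → w ≢ u
  adj⇒≢ {u} a refl = true≢false (trans (sym a) (adj-irrefl G u))

  private
    bit-injective : ∀ {a b} → bit a ≡ bit b → a ≡ b
    bit-injective refl = refl
    bit≢self : ∀ {a} → bit a ≢ self
    bit≢self ()

  -- A move to a position that the table records as lost, not just any move.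
  record Move (t : Tree) (s : Vec Bool n) (u w : Fin n) : Set where
    constructor mkMove
    field
      edge  : adj G u w ≡ true
      u∈s   : lookup s u ≡ true
      w∈s   : lookup s w ≡ true
      after : holds t (rem s u w) ≡ true

  stuck-false⇒move : ∀ t s → stuck t s (markedRows G) ≡ false → ∃[ u ] ∃[ w ] Move t s u w
  stuck-false⇒move t s p with u , q ← stuck-false t s (markedRows G) p
    with c , w , r≡ , w∈s , h ← seek-sound t s (row u) q with w ≟ u
  ... | yes refl = contradiction (trans (sym r≡) (row-self u)) bit≢self
  ... | no w≢u   = u , w , mkMove (bit-injective (trans (sym (row-bit w≢u)) r≡))
      (c u (row-self u)) w∈s
    (subst (λ z → holds t (z [ w ]≔ false) ≡ true) (del-row u s) h)

  stuck-true⇒no-move : ∀ t s → stuck t s (markedRows G) ≡ true → ∀ {u w} → ¬ Move t s u w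
  stuck-true⇒no-move t s p {u} {w} (mkMove e u∈s w∈s h) = true≢false (trans
    (sym (seek-complete t s (row u) c w
      ( trans (row-bit (adj⇒≢ e)) (cong bit e) , w∈s
      , subst (λ z → holds t (z [ w ]≔ false) ≡ true) (sym (del-row u s)) h)))
    (stuck-true t s (markedRows G) p u))
    where
    c : Contains s (row u)
    c x q with x ≟ u
    ... | yes refl = u∈s
    ... | no x≢u   = contradiction (trans (sym (row-bit x≢u)) q) bit≢self

-- Twins

match-sound : ∀ {n} (r s : Row n) → match r s ≡ true → ∀ k → agree (lookup r k) (lookup s k) ≡ true
match-sound (a ∷ r) (b ∷ s) p k with agree a b in eq
match-sound (a ∷ r) (b ∷ s) p zero    | true = eq
match-sound (a ∷ r) (b ∷ s) p (suc k) | true = match-sound r s p k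

match-complete : ∀ {n} (r s : Row n) → (∀ k → agree (lookup r k) (lookup s k) ≡ true) →
    match r s ≡ true
match-complete []      []      h = refl
match-complete (a ∷ r) (b ∷ s) h rewrite h zero = match-complete r s (h ∘ suc)

agree-bits : ∀ {a b} → agree (bit a) (bit b) ≡ true → a ≡ b
agree-bits {false} {false} p = refl
agree-bits {true}  {true}  p = refl

agree-refl : ∀ c → agree c c ≡ true
agree-refl (bit false) = refl
agree-refl (bit true)  = refl
agree-refl self        = refl

agree-selfʳ : ∀ c → agree c self ≡ true
agree-selfʳ (bit false) = refl
agree-selfʳ (bit true)  = refl
agree-selfʳ self        = refl

module _ {n} (G : Graph n) where

  match-row⇒ : ∀ {i j} → match (row G i) (row G j) ≡ true → ∀ {k} → k ≢ i → k ≢ j →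
      adj G i k ≡ adj G j k
  match-row⇒ {i} {j} m {k} k≢i k≢j = agree-bits
    (trans (sym (cong₂ agree (row-bit G k≢i) (row-bit G k≢j)))
        (match-sound (row G i) (row G j) m k))

  ⇒match-row : ∀ {i j} → (∀ {k} → k ≢ i → k ≢ j → adj G i k ≡ adj G j k) →
      match (row G i) (row G j) ≡ true
  ⇒match-row {i} {j} h = match-complete (row G i) (row G j) agrees
    where
    agrees : ∀ k → agree (lookup (row G i) k) (lookup (row G j) k) ≡ true
    agrees k with k ≟ i | k ≟ j
    ... | yes refl | _        rewrite row-self G k = refl
    ... | no _     | yes refl rewrite row-self G k = agree-selfʳ (lookup (row G i) k)
    ... | no k≢i   | no k≢j   rewrite row-bit G k≢i | row-bit G k≢j | h k≢i k≢j =
        agree-refl (bit (adj G j k))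

-- Automorphisms

-- Involutions suffice, and for them no inverse has to be carried along.
module _ {n} (σ : Fin n → Fin n) (σ-involutive : ∀ x → σ (σ x) ≡ x) where

  record Isomorphic (G H : Graph n) : Set where
    constructor isomorphic
    field
      preserves : ∀ x y → adj G x y ≡ adj H (σ x) (σ y)
  open Isomorphic

  private
    ≟-cong : ∀ x u → ⌊ x ≟ u ⌋ ≡ ⌊ σ x ≟ σ u ⌋
    ≟-cong x u with x ≟ u | σ x ≟ σ u
    ... | yes _   | yes _    = refl
    ... | no _    | no _     = refl
    ... | yes x≡u | no σx≢σu = contradiction (cong σ x≡u) σx≢σu
    ... | no x≢u  | yes σx≡σu =
      contradiction (trans (sym (σ-involutive x)) (trans (cong σ σx≡σu) (σ-involutive u))) x≢u

    ⊖-isomorphic : ∀ {G H} u w → Isomorphic G H → Isomorphic (G ⊖ u , w) (H ⊖ σ u , σ w)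
    preserves (⊖-isomorphic u w iso) x y =
        cong₂ _∧_ (preserves iso x y) (cong₂ _∧_ (survives x) (survives y))
      where
      survives : ∀ x → not (⌊ x ≟ u ⌋ ∨ ⌊ x ≟ w ⌋) ≡ not (⌊ σ x ≟ σ u ⌋ ∨ ⌊ σ x ≟ σ w ⌋)
      survives x = cong not (cong₂ _∨_ (≟-cong x u) (≟-cong x w))

  transfer : ∀ {p G H} → Isomorphic G H → WinningStrategy p G → WinningStrategy p H
  transfer iso (move u w e st) =
      move (σ u) (σ w) (subst T (preserves iso u w) e) (transfer (⊖-isomorphic u w iso) st)
  transfer {G = G} {H} iso (answer sts) = answer λ u w e →
    -- The opponent's move in `H` is pulled back along σ and answered in `G`; carrying the answer
    -- forward lands at σ (σ u), σ (σ w).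
    subst₂ (λ u′ w′ → WinningStrategy first (H ⊖ u′ , w′)) (σ-involutive u) (σ-involutive w)
      (transfer (⊖-isomorphic (σ u) (σ w) iso)
        (sts (σ u) (σ w)
          (subst T (sym (trans (preserves iso (σ u) (σ w))
                               (cong₂ (adj H) (σ-involutive u) (σ-involutive w)))) e)))

-- Positions as vertex sets

restrict : ∀ {n} → Graph n → Vec Bool n → Graph n
restrict G s = record
  { adj        = λ x y → adj G x y ∧ (lookup s x ∧ lookup s y)
  ; adj-sym    = λ x y → cong₂ _∧_ (adj-sym G x y) (∧-comm (lookup s x) (lookup s y))
  ; adj-irrefl = λ x → cong (_∧ (lookup s x ∧ lookup s x)) (adj-irrefl G x)
  }

restrict-isomorphic : ∀ {n} {G : Graph n} {s s′} σ inv →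
  Isomorphic σ inv G G → (∀ x → lookup s x ≡ lookup s′ (σ x)) →
  Isomorphic σ inv (restrict G s) (restrict G s′)
restrict-isomorphic σ inv (isomorphic iso) s≗ =
    isomorphic λ x y → cong₂ _∧_ (iso x y) (cong₂ _∧_ (s≗ x) (s≗ y))

transfer-id : ∀ {n p} {G H : Graph n} → (∀ x y → adj G x y ≡ adj H x y) →
              WinningStrategy p G → WinningStrategy p H
transfer-id iso = transfer id (λ _ → refl) (isomorphic iso)

module _ {n} (s : Vec Bool n) where

  rem-left : ∀ u w → lookup (rem s u w) u ≡ false
  rem-left u w with u ≟ w
  ... | yes refl = lookup∘update u (s [ u ]≔ false) false
  ... | no u≢w   = trans (lookup∘update′ u≢w (s [ u ]≔ false) false) (lookup∘update u s false)

  rem-right : ∀ u w → lookup (rem s u w) w ≡ false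
  rem-right u w = lookup∘update w (s [ u ]≔ false) false

  rem-other : ∀ {u w x} → x ≢ u → x ≢ w → lookup (rem s u w) x ≡ lookup s x
  rem-other {u} x≢u x≢w =
      trans (lookup∘update′ x≢w (s [ u ]≔ false) false) (lookup∘update′ x≢u s false)

  lookup-rem : ∀ u w x → lookup (rem s u w) x ≡ lookup s x ∧ not (⌊ x ≟ u ⌋ ∨ ⌊ x ≟ w ⌋)
  lookup-rem u w x with x ≟ u | x ≟ w
  ... | yes refl | _        = trans (rem-left x w) (sym (Bool.∧-zeroʳ (lookup s x)))
  ... | no _     | yes refl = trans (rem-right u x) (sym (Bool.∧-zeroʳ (lookup s x)))
  ... | no x≢u   | no x≢w   = trans (rem-other x≢u x≢w) (sym (Bool.∧-identityʳ (lookup s x)))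

  rem-comm : ∀ u w x → lookup (rem s u w) x ≡ lookup (rem s w u) x
  rem-comm u w x = trans (lookup-rem u w x)
    (trans (cong (λ b → lookup s x ∧ not b) (Bool.∨-comm ⌊ x ≟ u ⌋ ⌊ x ≟ w ⌋))
        (sym (lookup-rem w u x)))

restrict-rem : ∀ {n} (G : Graph n) s u w x y →
               adj (restrict G (rem s u w)) x y ≡ adj (restrict G s ⊖ u , w) x y
restrict-rem G s u w x y rewrite lookup-rem s u w x | lookup-rem s u w y =
  shuffle (adj G x y) (lookup s x) (lookup s y) _ _
  where
  shuffle : ∀ a b c d e → a ∧ ((b ∧ d) ∧ (c ∧ e)) ≡ (a ∧ (b ∧ c)) ∧ (d ∧ e)
  shuffle false b     c     d     e = refl
  shuffle true  false c     d     e = refl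
  shuffle true  true  false d     e = Bool.∧-zeroʳ d
  shuffle true  true  true  d     e = refl

∣[]≔false∣≤ : ∀ {n} (s : Vec Bool n) u → ∣ s [ u ]≔ false ∣ ≤ ∣ s ∣
∣[]≔false∣≤ (false ∷ s) zero    = ≤-refl
∣[]≔false∣≤ (true ∷ s)  zero    = n≤1+n _
∣[]≔false∣≤ (false ∷ s) (suc u) = ∣[]≔false∣≤ s u
∣[]≔false∣≤ (true ∷ s)  (suc u) = s≤s (∣[]≔false∣≤ s u)

∣[]≔false∣< : ∀ {n} (s : Vec Bool n) u → lookup s u ≡ true → ∣ s [ u ]≔ false ∣ < ∣ s ∣
∣[]≔false∣< (true ∷ s)  zero    p = ≤-refl
∣[]≔false∣< (false ∷ s) (suc u) p = ∣[]≔false∣< s u p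
∣[]≔false∣< (true ∷ s)  (suc u) p = s≤s (∣[]≔false∣< s u p)

rem-smaller : ∀ {n} (s : Vec Bool n) u w → lookup s u ≡ true → ∣ rem s u w ∣ < ∣ s ∣
rem-smaller s u w p = ≤-<-trans (∣[]≔false∣≤ (s [ u ]≔ false) w) (∣[]≔false∣< s u p)

canonical? : ∀ {n m} (rows : Vec (Row n) m) s →
  (∃[ i ] ∃[ j ] i Fin.< j × match (lookup rows i) (lookup rows j) ≡ true
                 × lookup s j ≡ true × lookup s i ≡ false)
  ⊎ Canonical rows s
canonical? rows s
  with any? (λ i → any? λ j → i Fin.<? j ×-dec (match (lookup rows i) (lookup rows j) Bool.≟ true)
                             ×-dec (lookup s j Bool.≟ true) ×-dec (lookup s i Bool.≟ false))
... | yes (i , j , violated) = inj₁ (i , j , violated)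
... | no ¬violated = inj₂ canonical
  where
  canonical : Canonical rows s
  canonical i j i<j m j∈s with lookup s i in eq
  ... | true  = refl
  ... | false = contradiction (i , j , i<j , m , j∈s , eq) ¬violated

-- Transpositions of twins

module _ {n} (a b : Fin n) where

  swap : Fin n → Fin n
  swap x with x ≟ a | x ≟ b
  ... | yes _ | _     = b
  ... | no _  | yes _ = a
  ... | no _  | no _  = x

  swap-a : swap a ≡ b
  swap-a with a ≟ a | a ≟ b
  ... | yes _  | _ = refl
  ... | no a≢a | _ = contradiction refl a≢a

  swap-b : swap b ≡ a
  swap-b with b ≟ a | b ≟ b
  ... | yes b≡a | _      = b≡a
  ... | no _    | yes _  = refl
  ... | no _    | no b≢b = contradiction refl b≢b

  swap-other : ∀ {x} → x ≢ a → x ≢ b → swap x ≡ x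
  swap-other {x} x≢a x≢b with x ≟ a | x ≟ b
  ... | yes x≡a | _       = contradiction x≡a x≢a
  ... | no _    | yes x≡b = contradiction x≡b x≢b
  ... | no _    | no _    = refl

  data View : Fin n → Set where
    is-a  : View a
    is-b  : View b
    other : ∀ {x} → x ≢ a → x ≢ b → View x

  view : ∀ x → View x
  view x with x ≟ a | x ≟ b
  ... | yes refl | _        = is-a
  ... | no _     | yes refl = is-b
  ... | no x≢a   | no x≢b   = other x≢a x≢b

  swap-involutive : ∀ x → swap (swap x) ≡ x
  swap-involutive x with view x
  ... | is-a          = trans (cong swap swap-a) swap-b
  ... | is-b          = trans (cong swap swap-b) swap-a
  ... | other x≢a x≢b = trans (cong swap (swap-other x≢a x≢b)) (swap-other x≢a x≢b)

  module _ (G : Graph n) (twin : ∀ {k} → k ≢ a → k ≢ b → adj G a k ≡ adj G b k) where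

    private
      twinˢ : ∀ {k} → k ≢ a → k ≢ b → adj G k a ≡ adj G k b
      twinˢ {k} k≢a k≢b = trans (adj-sym G k a) (trans (twin k≢a k≢b) (adj-sym G b k))

    swap-automorphism : Isomorphic swap swap-involutive G G
    swap-automorphism = isomorphic preserved
      where
      preserved : ∀ x y → adj G x y ≡ adj G (swap x) (swap y)
      preserved x y with view x | view y
      ... | is-a | is-a rewrite swap-a = trans (adj-irrefl G a) (sym (adj-irrefl G b))
      ... | is-a | is-b rewrite swap-a | swap-b = adj-sym G a b
      ... | is-a | other p q rewrite swap-a | swap-other p q = twin p q
      ... | is-b | is-a rewrite swap-a | swap-b = adj-sym G b a
      ... | is-b | is-b rewrite swap-b = trans (adj-irrefl G b) (sym (adj-irrefl G a))
      ... | is-b | other p q rewrite swap-b | swap-other p q = sym (twin p q)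
      ... | other p q | is-a rewrite swap-a | swap-other p q = twinˢ p q
      ... | other p q | is-b rewrite swap-b | swap-other p q = sym (twinˢ p q)
      ... | other p q | other p′ q′ rewrite swap-other p q | swap-other p′ q′ = refl

    -- Swapping the twins a and b is an automorphism. It fixes w, and since both a and b lie in `s`,
    -- it maps s - b - w onto s - a - w.
    exchange : ∀ {p s w} → a ≢ b → a ≢ w → b ≢ w → lookup s a ≡ true → lookup s b ≡ true →
               WinningStrategy p (restrict G (rem s b w)) →
               WinningStrategy p (restrict G (rem s a w))
    exchange {p} {s} {w} a≢b a≢w b≢w a∈s b∈s =
      transfer swap swap-involutive
        (restrict-isomorphic {s = rem s b w} {rem s a w} swap swap-involutive
          swap-automorphism same)
      where
      same : ∀ x → lookup (rem s b w) x ≡ lookup (rem s a w) (swap x)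
      same x with view x
      ... | is-a rewrite swap-a = trans (rem-other s a≢b a≢w)
        (trans a∈s (trans (sym b∈s) (sym (rem-other s (a≢b ∘ sym) b≢w))))
      ... | is-b rewrite swap-b = trans (rem-left s b w) (sym (rem-left s a w))
      ... | other x≢a x≢b rewrite swap-other x≢a x≢b with x ≟ w
      ...   | yes refl = trans (rem-right s b x) (sym (rem-right s a x))
      ...   | no x≢w   = trans (rem-other s x≢b x≢w) (sym (rem-other s x≢a x≢w))

-- Correctness

module _ {n} (G : Graph n) where

  private
    rows = markedRows G

    T⇒≡ : ∀ {b} → T b → b ≡ true
    T⇒≡ {true} _ = refl

    ≡⇒T : ∀ {b} → b ≡ true → T b
    ≡⇒T refl = _

    ∧-true : ∀ {a b} → a ∧ b ≡ true → a ≡ true × b ≡ true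
    ∧-true {true} p = refl , p

  -- Absence from the table says nothing about a set that is not canonical, hence the extra premise
  -- of `wins`. Outcomes are claimed only below size r.
  record Correct (t : Tree) (r : ℕ) : Set where
    field
      canonical : ∀ s → holds t s ≡ true → Canonical rows s
      loses     : ∀ s → ∣ s ∣ < r → holds t s ≡ true → WinningStrategy second (restrict G s)
      wins      : ∀ s → ∣ s ∣ < r → Canonical rows s → holds t s ≡ false →
          WinningStrategy first (restrict G s)
  open Correct

  module _ {t r} (correct : Correct t r) where

    stuck-false⇒wins : ∀ s → ∣ s ∣ < suc r → stuck t s rows ≡ false →
        WinningStrategy first (restrict G s)
    stuck-false⇒wins s (s≤s ∣s∣≤r) p with u , w , mkMove e u∈s w∈s h ← stuck-false⇒move G t s p =
      move u w (≡⇒T (cong₂ _∧_ e (cong₂ _∧_ u∈s w∈s)))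
        (transfer-id (restrict-rem G s u w)
          (loses correct (rem s u w) (<-≤-trans (rem-smaller s u w u∈s) ∣s∣≤r) h))

    stuck-true⇒loses : ∀ s → ∣ s ∣ < suc r → Canonical rows s → stuck t s rows ≡ true →
                       WinningStrategy second (restrict G s)
    stuck-true⇒loses s (s≤s ∣s∣≤r) can p = answer reply
      where
      -- The termination measure: a later twin is closer to the end, so each exchange lowers the sum
      -- of the two distances.
      distance : Fin n → ℕ
      distance u = n ∸ toℕ u

      closer : ∀ {a b} → a Fin.< b → distance b < distance a
      closer {a} {b} a<b = ∸-monoʳ-< a<b (<⇒≤ (toℕ<n b))

      -- If s - u - w is not canonical, then one of u and w has a later twin in s,
      -- and exchanging it for that twin does not affect the outcome.
      winning : ∀ k u w → distance u + distance w < k → adj G u w ≡ true →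
                lookup s u ≡ true → lookup s w ≡ true →
                WinningStrategy first (restrict G (rem s u w))
      winning (suc k) u w (s≤s d≤k) e u∈s w∈s with canonical? rows (rem s u w)
      ... | inj₂ can′ = wins correct (rem s u w)
          (<-≤-trans (rem-smaller s u w u∈s) ∣s∣≤r) can′ missing
        where
        missing : holds t (rem s u w) ≡ false
        missing with holds t (rem s u w) in h
        ... | false = refl
        ... | true  = contradiction (mkMove e u∈s w∈s h) (stuck-true⇒no-move G t s p)
      ... | inj₁ (a , b , a<b , m , b∈rem , a∉rem) = by-cases (a ≟ u) (a ≟ w)
        where
        b≢u : b ≢ u
        b≢u refl = contradiction (trans (sym b∈rem) (rem-left s b w)) λ ()
        b≢w : b ≢ w
        b≢w refl = contradiction (trans (sym b∈rem) (rem-right s u b)) λ ()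
        b∈s : lookup s b ≡ true
        b∈s = trans (sym (rem-other s b≢u b≢w)) b∈rem
        by-cases : Dec (a ≡ u) → Dec (a ≡ w) → WinningStrategy first (restrict G (rem s u w))
        by-cases (yes refl) _ =
          exchange u b G (match-row⇒ G m) {s = s} (b≢u ∘ sym) (adj⇒≢ G e ∘ sym) b≢w u∈s b∈s
            (winning k b w (<-≤-trans (+-monoˡ-< (distance w) (closer a<b)) d≤k)
              (trans (sym (match-row⇒ G m (adj⇒≢ G e) (b≢w ∘ sym))) e) b∈s w∈s)
        by-cases (no _) (yes refl) =
          transfer id (λ _ → refl)
              (restrict-isomorphic {s = rem s w u} {rem s u w} id (λ _ → refl)
              (isomorphic λ _ _ → refl) (rem-comm s w u))
            (exchange w b G (match-row⇒ G m) {s = s} (b≢w ∘ sym) (adj⇒≢ G e) b≢u w∈s b∈s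
              (winning k b u
                (<-≤-trans (subst (distance b + distance u <_) (+-comm (distance w) (distance u))
                  (+-monoˡ-< (distance u) (closer a<b))) d≤k)
                (trans (sym (match-row⇒ G m (adj⇒≢ G e ∘ sym) (b≢u ∘ sym)))
                    (trans (adj-sym G w u) e)) b∈s u∈s))
        -- As `s` is canonical, b ∈ s forces a ∈ s. So a can be missing after the move only if it is
        -- u or w.
        by-cases (no a≢u) (no a≢w) = contradiction
          (trans (sym (can a b a<b m b∈s)) (trans (sym (rem-other s a≢u a≢w)) a∉rem)) λ ()

      reply : ∀ u w → Edge (restrict G s) u w → WinningStrategy first (restrict G s ⊖ u , w)
      reply u w edge with e , uw ← ∧-true (T⇒≡ edge) with u∈s , w∈s ← ∧-true uw =
        transfer-id (restrict-rem G s u w) (winning _ u w ≤-refl e u∈s w∈s)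

  private
    avoids-none : ∀ s → Avoids (none {n}) s
    avoids-none s i _ = lookup-replicate i false

    refine : ∀ {t r} → Correct t r →
        Correct (build (λ s → stuck t s rows) (twins rows) none) (suc r)
    refine {t} {r} correct = record
      { canonical = λ s h → proj₂ (ok-sound rows none s (proj₁ (split s h)))
      ; loses     = λ s lt h → stuck-true⇒loses correct s lt
                      (proj₂ (ok-sound rows none s (proj₁ (split s h)))) (proj₂ (split s h))
      ; wins      = λ s lt can h → stuck-false⇒wins correct s lt
                      (trans (sym (cong (_∧ stuck t s rows)
                          (ok-complete rows none s (avoids-none s) can)))
                        (trans (sym (holds-build _ (twins rows) none s)) h))
      }
      where
      split : ∀ s → holds (build (λ s → stuck t s rows) (twins rows) none) s ≡ true →
              ok (twins rows) none s ≡ true × stuck t s rows ≡ true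
      split s h = ∧-true (trans (sym (holds-build _ (twins rows) none s)) h)

  table-correct : ∀ r → Correct (table r rows) r
  table-correct zero = record
    { canonical = λ s h → contradiction (trans (sym h) (holds-nil s)) λ ()
    ; loses     = λ s ()
    ; wins      = λ s ()
    }
  table-correct (suc r) = refine (table-correct r)

  private
    restrict-all : ∀ x y → adj (restrict G all) x y ≡ adj G x y
    restrict-all x y rewrite lookup-replicate x true | lookup-replicate y true =
        Bool.∧-identityʳ (adj G x y)

  secondWins-correct : WinningStrategy (if secondWins G then second else first) G
  secondWins-correct with secondWins G in eq
  -- The full set has n elements, one more than the last table covers; the final call of `stuckᶠ`
  -- acts as one further round.
  ... | true = transfer-id restrict-all (stuck-true⇒loses (table-correct n) all (s≤s (∣p∣≤n all))
                 (λ i j _ _ _ → lookup-replicate i true) eq)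
  ... | false = transfer-id restrict-all
      (stuck-false⇒wins (table-correct n) all (s≤s (∣p∣≤n all)) eq)

-- Size of a table

leaves : ∀ {n} → Triangle n → Vec Bool n → ℕ
leaves []       []         = 1
leaves (t ∷ tw) (b ∷ mask) = leaves tw (orVec mask t) + (if b then 0 else leaves tw mask)

-- Leaving a vertex out is always allowed, so the path of the empty set is never pruned.
leaves>0 : ∀ {n} (tw : Triangle n) mask → 0 < leaves tw mask
leaves>0 []       []         = z<s
leaves>0 (t ∷ tw) (b ∷ mask) = ≤-trans (leaves>0 tw (orVec mask t)) (m≤m+n _ _)

nodeCost : ℕ → ℕ
nodeCost n = K + 3 * linear n

private
  -- The cost X of an inner node is charged to a leaf of its first subtree, which has one.
  add-node : ∀ {c₁ c₂ l₁ l₂} X Z → 0 < l₁ → c₁ ≤ l₁ * Z → c₂ ≤ l₂ * Z →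
      X + (c₁ + c₂) ≤ (l₁ + l₂) * (X + Z)
  add-node {c₁} {c₂} {l₁@(suc k)} {l₂} X Z _ p q = begin
    X + (c₁ + c₂)                          ≤⟨ +-monoʳ-≤ X (+-mono-≤ p q) ⟩
    X + (l₁ * Z + l₂ * Z)                  ≤⟨ m≤m+n _ (k * X + l₂ * X) ⟩
    X + (l₁ * Z + l₂ * Z) + (k * X + l₂ * X) ≡⟨ lemma X Z k l₂ ⟩
    (l₁ + l₂) * (X + Z)                    ∎
    where
    open ≤-Reasoning
    lemma : ∀ X Z k l → X + (suc k * Z + l * Z) + (k * X + l * X) ≡ (suc k + l) * (X + Z)
    lemma = solve-∀

-- Every node lies above a leaf. It suffices that each leaf pays for the m nodes on its path and for
-- its own test.
buildCost≤ : ∀ {m} n l (tw : Triangle m) mask →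
    buildCost n l tw mask ≤ leaves tw mask * (m * nodeCost n + (K + l))
buildCost≤ n l [] [] = ≤-reflexive (sym (*-identityˡ (K + l)))
buildCost≤ {suc m} n l (t ∷ tw) (b ∷ mask) =
  ≤-trans (add-node (nodeCost n) (m * nodeCost n + (K + l)) (leaves>0 tw (orVec mask t))
             (buildCost≤ n l tw (orVec mask t)) (rest b))
    (≤-reflexive (cong (leaves (t ∷ tw) (b ∷ mask) *_)
        (sym (+-assoc (nodeCost n) (m * nodeCost n) (K + l)))))
  where
  rest : ∀ b → (if b then 0 else buildCost n l tw mask)
      ≤ (if b then 0 else leaves tw mask) * (m * nodeCost n + (K + l))
  rest true  = z≤n
  rest false = buildCost≤ n l tw mask

-- Finite products

prod-mono : ∀ {w} {f g : Fin w → ℕ} → (∀ p → f p ≤ g p) → prod f ≤ prod g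
prod-mono {zero}  f≤g = ≤-refl
prod-mono {suc w} f≤g = *-mono-≤ (f≤g zero) (prod-mono (f≤g ∘ suc))

prod-pos : ∀ {w} {f : Fin w → ℕ} → (∀ p → 0 < f p) → 0 < prod f
prod-pos {zero}  f>0 = z<s
prod-pos {suc w} f>0 = *-mono-≤ (f>0 zero) (prod-pos (f>0 ∘ suc))

-- A product is additive in each single factor.
prod-split : ∀ {w} {f g h : Fin w → ℕ} q → f q ≡ g q + h q →
             (∀ p → p ≢ q → f p ≡ g p) → (∀ p → p ≢ q → f p ≡ h p) → prod f ≡ prod g + prod h
prod-split {f = f} {g} {h} zero fq f≡g f≡h = begin
  f zero * prod (f ∘ suc)                                     ≡⟨ cong (_* prod (f ∘ suc)) fq ⟩
  (g zero + h zero) * prod (f ∘ suc)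
      ≡⟨ *-distribʳ-+ (prod (f ∘ suc)) (g zero) (h zero) ⟩
  g zero * prod (f ∘ suc) + h zero * prod (f ∘ suc)
    ≡⟨ cong₂ (λ x y → g zero * x + h zero * y) (prod-cong λ p → f≡g (suc p) λ ())
        (prod-cong λ p → f≡h (suc p) λ ()) ⟩
  prod g + prod h                                             ∎
  where open ≡-Reasoning
prod-split {f = f} {g} {h} (suc q) fq f≡g f≡h = begin
  f zero * prod (f ∘ suc)
    ≡⟨ cong (f zero *_) (prod-split q fq (λ p p≢q → f≡g (suc p) (p≢q ∘ suc-injective))
                                         (λ p p≢q → f≡h (suc p) (p≢q ∘ suc-injective))) ⟩
  f zero * (prod (g ∘ suc) + prod (h ∘ suc))                  ≡⟨ *-distribˡ-+ (f zero) _ _ ⟩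
  f zero * prod (g ∘ suc) + f zero * prod (h ∘ suc)
    ≡⟨ cong₂ (λ x y → x * prod (g ∘ suc) + y * prod (h ∘ suc)) (f≡g zero λ ()) (f≡h zero λ ()) ⟩
  prod g + prod h                                             ∎
  where open ≡-Reasoning

sum-ones : ∀ w → sum {w} (λ _ → 1) ≡ w
sum-ones zero    = refl
sum-ones (suc w) = cong suc (sum-ones w)

-- Inequality of arithmetic and geometric means

2ab≤a²+b² : ∀ a b → 2 * (a * b) ≤ a * a + b * b
2ab≤a²+b² a b with ≤-total a b
... | inj₁ a≤b with d , refl ← m≤n⇒∃[o]m+o≡n a≤b =
  ≤-trans (m≤m+n _ (d * d)) (≤-reflexive (lemma a d))
  where
  lemma : ∀ a d → 2 * (a * (a + d)) + d * d ≡ a * a + (a + d) * (a + d)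
  lemma = solve-∀
2ab≤a²+b² a b | inj₂ b≤a with d , refl ← m≤n⇒∃[o]m+o≡n b≤a =
  ≤-trans (m≤m+n _ (d * d)) (≤-reflexive (lemma b d))
  where
  lemma : ∀ a d → 2 * ((a + d) * a) + d * d ≡ (a + d) * (a + d) + a * a
  lemma = solve-∀

^-distribʳ-* : ∀ m a b → (a * b) ^ m ≡ a ^ m * b ^ m
^-distribʳ-* zero    a b = refl
^-distribʳ-* (suc m) a b = trans (cong (a * b *_) (^-distribʳ-* m a b)) (lemma a b (a ^ m) (b ^ m))
  where
  lemma : ∀ a b c d → a * b * (c * d) ≡ a * c * (b * d)
  lemma = solve-∀

-- Bernoulli's inequality x^(k+1) ≥ 1 + (k+1)(x - 1) at x = a/b, multiplied by b^(k+1) and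
-- rearranged so that neither division nor subtraction remains.
bernoulli : ∀ k a b → suc k * (a * b ^ k) ≤ a ^ suc k + k * b ^ suc k
bernoulli zero    a b = ≤-reflexive (lemma a)
  where
  lemma : ∀ a → 1 * (a * 1) ≡ a * 1 + 0
  lemma = solve-∀
-- The term added on both sides raises the coefficient of a b^(k+1) from k + 2 to 2(k + 1), which
-- makes 2ab ≤ a² + b² applicable.
bernoulli (suc k) a b = +-cancelʳ-≤ (k * (a * (b * P))) _ _ (begin
  (2 + k) * (a * (b * P)) + k * (a * (b * P))              ≡⟨ e₁ k a b P ⟩
  suc k * P * (2 * (a * b))
      ≤⟨ *-monoʳ-≤ (suc k * P) (2ab≤a²+b² a b) ⟩
  suc k * P * (a * a + b * b)                              ≡⟨ e₂ k a b P ⟩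
  a * (suc k * (a * P)) + suc k * (b * (b * P))
      ≤⟨ +-monoˡ-≤ _ (*-monoʳ-≤ a (bernoulli k a b)) ⟩
  a * (a * Q + k * (b * P)) + suc k * (b * (b * P))        ≡⟨ e₃ k a b P Q ⟩
  a * (a * Q) + suc k * (b * (b * P)) + k * (a * (b * P))  ∎)
  where
  open ≤-Reasoning
  P = b ^ k
  Q = a ^ k
  e₁ : ∀ k a b P → (2 + k) * (a * (b * P)) + k * (a * (b * P)) ≡ suc k * P * (2 * (a * b))
  e₁ = solve-∀
  e₂ : ∀ k a b P → suc k * P * (a * a + b * b) ≡ a * (suc k * (a * P)) + suc k * (b * (b * P))
  e₂ = solve-∀
  e₃ : ∀ k a b P Q → a * (a * Q + k * (b * P)) + suc k * (b * (b * P)) ≡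
                     a * (a * Q) + suc k * (b * (b * P)) + k * (a * (b * P))
  e₃ = solve-∀

-- For k > 0 this is (S/k)^k x ≤ ((x + S)/(k + 1))^(k+1), where S/k is the mean of k numbers and x
-- is a further one. It follows from `bernoulli` with the new and the old mean as a and b, both
-- scaled by k(k + 1).
amgm-step : ∀ k x S → suc k ^ suc k * (S ^ k * x) ≤ k ^ k * (x + S) ^ suc k
amgm-step zero x S = ≤-trans (m≤m+n _ S) (≤-reflexive (lemma x S))
  where
  lemma : ∀ x S → 1 * (1 * x) + S ≡ 1 * ((x + S) * 1)
  lemma = solve-∀
-- The added term is k ((k + 1) S)^(k+1), the last summand in `bernoulli`. A factor k is cancelled
-- as well, hence the separate case k = 0.
amgm-step k@(suc _) x S = *-cancelˡ-≤ k (+-cancelʳ-≤ (k * (suc k * S * (c * P))) _ _ (begin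
  k * (suc k * c * (P * x)) + k * (suc k * S * (c * P))   ≡⟨ e₁ k c P S x ⟩
  suc k * (k * (x + S) * (c * P))
    ≡⟨ cong (λ z → suc k * (k * (x + S) * z)) (sym (^-distribʳ-* k (suc k) S)) ⟩
  suc k * (k * (x + S) * (suc k * S) ^ k)
      ≤⟨ bernoulli k (k * (x + S)) (suc k * S) ⟩
  (k * (x + S)) ^ suc k + k * (suc k * S) ^ suc k
    ≡⟨ cong₂ (λ y z → y + k * (suc k * S * z)) (^-distribʳ-* (suc k) k (x + S))
        (^-distribʳ-* k (suc k) S) ⟩
  k ^ suc k * (x + S) ^ suc k + k * (suc k * S * (c * P))
      ≡⟨ cong (_+ k * (suc k * S * (c * P))) (*-assoc k (k ^ k) ((x + S) ^ suc k)) ⟩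
  k * (k ^ k * (x + S) ^ suc k) + k * (suc k * S * (c * P)) ∎))
  where
  open ≤-Reasoning
  c = suc k ^ k
  P = S ^ k
  e₁ : ∀ k c P S x → k * (suc k * c * (P * x)) + k * (suc k * S * (c * P))
      ≡ suc k * (k * (x + S) * (c * P))
  e₁ = solve-∀

n^n≢0 : ∀ n → NonZero (n ^ n)
-- Here 0 ^ 0 is 1, which also lets the induction in `amgm` pass from zero to one number.
n^n≢0 zero    = _
n^n≢0 (suc n) = m^n≢0 (suc n) (suc n)

-- That is, prod f ≤ (sum f / w)^w with the denominator cleared.
amgm : ∀ {w} (f : Fin w → ℕ) → w ^ w * prod f ≤ sum f ^ w
amgm {zero}  f = ≤-refl
amgm {suc k} f = *-cancelˡ-≤ (k ^ k) {{n^n≢0 k}} (begin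
  k ^ k * (suc k ^ suc k * (x * P))  ≡⟨ e₁ (k ^ k) (suc k ^ suc k) x P ⟩
  suc k ^ suc k * (k ^ k * P * x)    ≤⟨ *-monoʳ-≤ (suc k ^ suc k) (*-monoˡ-≤ x (amgm (f ∘ suc))) ⟩
  suc k ^ suc k * (S ^ k * x)        ≤⟨ amgm-step k x S ⟩
  k ^ k * (x + S) ^ suc k            ∎)
  where
  open ≤-Reasoning
  x = f zero
  P = prod (f ∘ suc)
  S = sum (f ∘ suc)
  e₁ : ∀ a b x P → a * (b * (x * P)) ≡ b * (a * P * x)
  e₁ = solve-∀

-- Sizes of the parts and the number of leaves

indicator : ∀ {w} → Fin w → Fin w → ℕ
indicator q p = if ⌊ q ≟ p ⌋ then 1 else 0

occurrences : ∀ {n w} → (Fin n → Fin w) → Fin w → ℕ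
occurrences part p = sum λ i → indicator (part i) p

sum-indicator : ∀ {w} (q : Fin w) → sum (indicator q) ≡ 1
sum-indicator {suc w} zero    = cong suc (sum-replicate-zero w)
sum-indicator {suc w} (suc q) = trans (sum-cong-≗ same) (sum-indicator q)
  where
  same : ∀ p → indicator (suc q) (suc p) ≡ indicator q p
  same p with q ≟ p
  ... | yes _ = refl
  ... | no _  = refl

sum-occurrences : ∀ {n w} (part : Fin n → Fin w) → sum (occurrences part) ≡ n
sum-occurrences {zero}  {w} part = sum-replicate-zero w
sum-occurrences {suc n} part =
    trans (∑-distrib-+ (indicator (part zero)) (occurrences (part ∘ suc)))
  (cong₂ _+_ (sum-indicator (part zero)) (sum-occurrences (part ∘ suc)))

factor : ∀ {n w} → (Fin w → Bool) → (Fin n → Fin w) → Fin w → ℕ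
factor isOpen part p = if isOpen p then suc (occurrences part p) else 1

factor>0 : ∀ {n w} isOpen (part : Fin n → Fin w) p → 0 < factor isOpen part p
factor>0 isOpen part p with isOpen p
... | true  = z<s
... | false = z<s

close : ∀ {w} → Fin w → (Fin w → Bool) → Fin w → Bool
close q isOpen p = isOpen p ∧ not ⌊ q ≟ p ⌋

≟-refl : ∀ {w} (q : Fin w) → ⌊ q ≟ q ⌋ ≡ true
≟-refl q with q ≟ q
... | yes _  = refl
... | no q≢q = contradiction refl q≢q

≟-≢ : ∀ {w} {p q : Fin w} → p ≢ q → ⌊ q ≟ p ⌋ ≡ false
≟-≢ {p = p} {q} p≢q with q ≟ p
... | yes q≡p = contradiction (sym q≡p) p≢q
... | no _    = refl

-- A part is open as long as none of its vertices has been left out. An open part with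
-- k vertices to come admits k + 1 choices, a closed part only one.
leaves≤ : ∀ {n m w} (rows : Vec (Row n) m) (part : Fin m → Fin w) →
  (∀ i j → i Fin.< j → part i ≡ part j → match (lookup rows i) (lookup rows j) ≡ true) →
  ∀ mask isOpen → (∀ i → isOpen (part i) ≡ false → lookup mask i ≡ true) →
  leaves (twins rows) mask ≤ prod (factor isOpen part)
leaves≤ [] part _ [] isOpen _ = prod-pos (factor>0 isOpen part)
leaves≤ {w = w} (r ∷ rows) part twin (b ∷ mask) isOpen masked = by-cases (isOpen q) refl
  where
  q = part zero
  ts = Vec.map (match r) rows
  twin′ : ∀ i j → i Fin.< j → part (suc i) ≡ part (suc j) →
      match (lookup rows i) (lookup rows j) ≡ true
  twin′ i j i<j = twin (suc i) (suc j) (s≤s i<j)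

  by-cases : ∀ c → isOpen q ≡ c → leaves (twins (r ∷ rows)) (b ∷ mask) ≤ prod (factor isOpen part)
  -- A closed part already misses a vertex, so vertex 0 is masked and only the branch that excludes
  -- it remains.
  by-cases false closed rewrite masked zero closed = begin
    leaves (twins rows) (orVec mask ts) + 0  ≡⟨ +-identityʳ _ ⟩
    leaves (twins rows) (orVec mask ts)
      ≤⟨ leaves≤ rows (part ∘ suc) twin′ (orVec mask ts) isOpen still-masked ⟩
    prod (factor isOpen (part ∘ suc))         ≤⟨ prod-mono grows ⟩
    prod (factor isOpen part)                 ∎
    where
    open ≤-Reasoning
    still-masked : ∀ i → isOpen (part (suc i)) ≡ false → lookup (orVec mask ts) i ≡ true
    still-masked i c rewrite lookup-orVec mask ts i | masked (suc i) c = refl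
    grows : ∀ p → factor isOpen (part ∘ suc) p ≤ factor isOpen part p
    grows p with isOpen p
    ... | true  = s≤s (m≤n+m _ (indicator q p))
    ... | false = ≤-refl
  -- Excluding vertex 0 closes its part, including it keeps the part open with one vertex fewer to
  -- come: k + 1 = 1 + k in the factor of q.
  by-cases true opened = begin
    leaves (twins rows) (orVec mask ts) + (if b then 0 else leaves (twins rows) mask)
      ≤⟨ +-mono-≤ (leaves≤ rows (part ∘ suc) twin′ (orVec mask ts) (close q isOpen) now-masked)
          (kept b) ⟩
    prod (factor (close q isOpen) (part ∘ suc)) + prod (factor isOpen (part ∘ suc))
      ≡⟨ prod-split {f = factor isOpen part} q at-q unchanged-closed unchanged ⟨
    prod (factor isOpen part) ∎
    where
    open ≤-Reasoning
    now-masked : ∀ i → close q isOpen (part (suc i)) ≡ false → lookup (orVec mask ts) i ≡ true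
    now-masked i c rewrite lookup-orVec mask ts i with isOpen (part (suc i)) in eq
    ... | false rewrite masked (suc i) eq = refl
    ... | true with q ≟ part (suc i)
    ...   | yes same rewrite lookup-map i (match r) rows | twin zero (suc i) z<s same =
        Bool.∨-zeroʳ (lookup mask i)
    ...   | no _ with () ← c
    kept : ∀ b → (if b then 0 else leaves (twins rows) mask) ≤ prod (factor isOpen (part ∘ suc))
    -- The partition may separate twins, so even a vertex of an open part can be masked. This only
    -- removes leaves.
    kept true  = z≤n
    kept false = leaves≤ rows (part ∘ suc) twin′ mask isOpen (masked ∘ suc)
    at-q : factor isOpen part q
        ≡ factor (close q isOpen) (part ∘ suc) q + factor isOpen (part ∘ suc) q
    at-q rewrite opened | ≟-refl q = refl
    unchanged : ∀ p → p ≢ q → factor isOpen part p ≡ factor isOpen (part ∘ suc) p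
    unchanged p p≢q rewrite ≟-≢ p≢q = refl
    unchanged-closed : ∀ p → p ≢ q → factor isOpen part p ≡ factor (close q isOpen) (part ∘ suc) p
    unchanged-closed p p≢q rewrite ≟-≢ p≢q | Bool.∧-identityʳ (isOpen p) = refl

leaves-bound : ∀ {n m w} (rows : Vec (Row n) m) (part : Fin m → Fin w) →
  (∀ i j → i Fin.< j → part i ≡ part j → match (lookup rows i) (lookup rows j) ≡ true) →
  w ^ w * leaves (twins rows) none ≤ (m + w) ^ w
leaves-bound {m = m} {w} rows part twin = begin
  w ^ w * leaves (twins rows) none
      ≤⟨ *-monoʳ-≤ (w ^ w) (leaves≤ rows part twin none (λ _ → true) λ i ()) ⟩
  w ^ w * prod (λ p → suc (occurrences part p))   ≤⟨ amgm (λ p → suc (occurrences part p)) ⟩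
  sum (λ p → suc (occurrences part p)) ^ w        ≡⟨ cong (_^ w) total≡ ⟩
  (m + w) ^ w                                     ∎
  where
  open ≤-Reasoning
  total≡ : sum (λ p → suc (occurrences part p)) ≡ m + w
  total≡ = trans (∑-distrib-+ (λ _ → 1) (occurrences part))
    (trans (cong₂ _+_ (sum-ones w) (sum-occurrences part)) (+-comm w m))

-- Twin partitions bound the number of states

lookup-remove : ∀ {n} (p : Subset n) {x k} → k ≢ x → lookup (p - x) k ≡ lookup p k
lookup-remove (b ∷ p) {zero}  {zero}  k≢x = contradiction refl k≢x
lookup-remove (b ∷ p) {zero}  {suc k} k≢x = cong (λ q → lookup q k) (p─⊥≡p p)
lookup-remove (b ∷ p) {suc x} {zero}  k≢x = refl
lookup-remove (b ∷ p) {suc x} {suc k} k≢x = lookup-remove p (k≢x ∘ cong suc)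

twins⇒match : ∀ {n} (G : Graph n) {i j} → Twins G i j → match (row G i) (row G j) ≡ true
twins⇒match G {i} {j} tw = ⇒match-row G λ {k} k≢i k≢j → begin
  adj G i k               ≡⟨ lookup∘tabulate (adj G i) k ⟨
  lookup (N G i) k        ≡⟨ lookup-remove (N G i) k≢j ⟨
  lookup (N G i - j) k    ≡⟨ cong (λ q → lookup q k) tw ⟩
  lookup (N G j - i) k    ≡⟨ lookup-remove (N G j) k≢i ⟩
  lookup (N G j) k        ≡⟨ lookup∘tabulate (adj G j) k ⟩
  adj G j k               ∎
  where open ≡-Reasoning

states : ∀ {n} → Graph n → ℕ
states G = leaves (twins (markedRows G)) none

states≤ : ∀ {n} (G : Graph n) {w} → TwinPartition G w → w ^ w * states G ≤ (n + w) ^ w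
states≤ G (part , _ , twin) =
    leaves-bound (markedRows G) part λ i j _ same → twins⇒match G (twin i j same)

-- Polynomial bounds

-- The base `suc n` is never 0, so its powers grow with the exponent, as `poly-+` requires.
Polynomial : (ℕ → ℕ) → Set
Polynomial f = ∃[ c ] ∃[ k ] ∀ n → f n ≤ c * suc n ^ k

poly-≤ : ∀ {f g} → (∀ n → f n ≤ g n) → Polynomial g → Polynomial f
poly-≤ f≤g (c , k , g≤) = c , k , λ n → ≤-trans (f≤g n) (g≤ n)

poly-const : ∀ a → Polynomial (λ _ → a)
poly-const a = a , 0 , λ n → ≤-reflexive (sym (*-identityʳ a))

poly-suc : Polynomial suc
poly-suc = 1 , 1 , λ n → ≤-reflexive (lemma n)
  where
  lemma : ∀ n → suc n ≡ 1 * (suc n * 1)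
  lemma = solve-∀

poly-+ : ∀ {f g} → Polynomial f → Polynomial g → Polynomial (λ n → f n + g n)
poly-+ {f} {g} (c , k , f≤) (d , l , g≤) = c + d , k + l , λ n → begin
  f n + g n                                ≤⟨ +-mono-≤ (f≤ n) (g≤ n) ⟩
  c * suc n ^ k + d * suc n ^ l
    ≤⟨ +-mono-≤ (*-monoʳ-≤ c (^-monoʳ-≤ (suc n) (m≤m+n k l)))
        (*-monoʳ-≤ d (^-monoʳ-≤ (suc n) (m≤n+m l k))) ⟩
  c * suc n ^ (k + l) + d * suc n ^ (k + l)  ≡⟨ *-distribʳ-+ (suc n ^ (k + l)) c d ⟨
  (c + d) * suc n ^ (k + l)                ∎
  where open ≤-Reasoning

poly-* : ∀ {f g} → Polynomial f → Polynomial g → Polynomial (λ n → f n * g n)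
poly-* {f} {g} (c , k , f≤) (d , l , g≤) = c * d , k + l , λ n → begin
  f n * g n                            ≤⟨ *-mono-≤ (f≤ n) (g≤ n) ⟩
  c * suc n ^ k * (d * suc n ^ l)      ≡⟨ lemma c (suc n ^ k) d (suc n ^ l) ⟩
  c * d * (suc n ^ k * suc n ^ l)      ≡⟨ cong (c * d *_) (^-distribˡ-+-* (suc n) k l) ⟨
  c * d * suc n ^ (k + l)              ∎
  where
  open ≤-Reasoning
  lemma : ∀ a b c d → a * b * (c * d) ≡ a * c * (b * d)
  lemma = solve-∀

-- The recursion adds m increments to a start value; as g is increasing, each of these m + 1
-- summands is at most a + g m.
unroll : ∀ (f g : ℕ → ℕ) a → (∀ m → g m ≤ g (suc m)) → f 0 ≤ a →
    (∀ m → f (suc m) ≤ a + (g m + f m)) →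
         ∀ m → f m ≤ suc m * (a + g m)
unroll f g a g↑ f₀ f₊ zero    = ≤-trans f₀ (≤-trans (m≤m+n a (g 0)) (m≤m+n (a + g 0) 0))
unroll f g a g↑ f₀ f₊ (suc m) = begin
  f (suc m)                                ≤⟨ f₊ m ⟩
  a + (g m + f m)                          ≡⟨ +-assoc a (g m) (f m) ⟨
  (a + g m) + f m                          ≤⟨ +-monoʳ-≤ (a + g m) (unroll f g a g↑ f₀ f₊ m) ⟩
  (a + g m) + suc m * (a + g m)            ≤⟨ *-monoʳ-≤ (2 + m) (+-monoʳ-≤ a (g↑ m)) ⟩
  suc (suc m) * (a + g (suc m))            ∎
  where open ≤-Reasoning

poly-linear : Polynomial linear
poly-linear = poly-* poly-suc (poly-const K)

linear↑ : ∀ m → linear m ≤ linear (suc m)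
linear↑ m = linear-mono m (suc m) (n≤1+n m)

poly-rowwise : Polynomial (λ n → rowwise n n)
poly-rowwise = poly-* poly-suc (poly-+ (poly-const K) poly-linear)

poly-twins : Polynomial (λ n → twinsCost n n)
poly-twins = poly-≤
  (λ n → unroll (λ m → twinsCost m n) (λ m → rowwise m n) K
      (λ m → *-monoˡ-≤ (K + linear n) (n≤1+n (suc m)))
           ≤-refl (λ m → ≤-refl) n)
  (poly-* poly-suc (poly-+ (poly-const K) poly-rowwise))

poly-seek : Polynomial seekCost
poly-seek = poly-≤
  (unroll seekCost linear K linear↑ ≤-refl
      (λ m → ≤-reflexive (cong (K +_) (+-comm (seekCost m) (linear m)))))
  (poly-* poly-suc (poly-+ (poly-const K) poly-linear))

poly-stuck : Polynomial (λ n → stuckCost n n)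
poly-stuck = poly-* poly-suc (poly-+ (poly-const K) poly-seek)

poly-overhead : Polynomial overhead
poly-overhead = poly-+ poly-rowwise
    (poly-+ poly-twins (poly-+ poly-linear (poly-+ poly-linear poly-stuck)))

costPerState : ℕ → ℕ
costPerState n = K + overhead n + suc n * (K + (suc n * nodeCost n + (K + stuckCost n n)))

-- Abstract, lest the coefficients be evaluated when the theorem is checked.
abstract
  poly-costPerState : Polynomial costPerState
  poly-costPerState = poly-+ (poly-+ (poly-const K) poly-overhead)
    (poly-* poly-suc (poly-+ (poly-const K)
      (poly-+ (poly-* poly-suc (poly-+ (poly-const K) (poly-* (poly-const 3) poly-linear)))
              (poly-+ (poly-const K) poly-stuck))))

private
  -- There is at least one state, so the costs incurred outside the rounds may be multiplied by the
  -- number s of states as well.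
  collect : ∀ k a b c d {i} n {x y s} → 0 < s → i ≤ suc n * (k + x) → x ≤ s * y →
            k + (a + (b + (c + (i + (c + d)))))
              ≤ s * (k + (a + (b + (c + (c + d)))) + suc n * (k + y))
  collect k a b c d {i} n {x} {y} {s@(suc r)} _ p q = begin
    k + (a + (b + (c + (i + (c + d)))))       ≡⟨ e₁ k a b c d i ⟩
    H + i
        ≤⟨ +-monoʳ-≤ H (≤-trans p (*-monoʳ-≤ (suc n) (+-monoʳ-≤ k q))) ⟩
    H + suc n * (k + s * y)                   ≤⟨ m≤m+n _ (r * H + suc n * (r * k)) ⟩
    H + suc n * (k + s * y) + (r * H + suc n * (r * k)) ≡⟨ e₂ H n k r y ⟩
    s * (H + suc n * (k + y))                 ∎
    where
    open ≤-Reasoning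
    H = k + (a + (b + (c + (c + d))))
    e₁ : ∀ k a b c d i → k + (a + (b + (c + (i + (c + d))))) ≡ k + (a + (b + (c + (c + d)))) + i
    e₁ = solve-∀
    e₂ : ∀ H n k r y → H + suc n * (k + suc r * y) + (r * H + suc n * (r * k))
        ≡ suc r * (H + suc n * (k + y))
    e₂ = solve-∀

solverCost≤ : ∀ {n} (G : Graph n) → solverCost G ≤ states G * costPerState n
solverCost≤ {n} G = collect K (rowwise n n) (twinsCost n n) (linear n) (stuckCost n n)
  {iterateCost n (markedRows G)} n {roundCost (markedRows G)}
  {suc n * nodeCost n + (K + stuckCost n n)} {states G}
  (leaves>0 (twins (markedRows G)) none) ≤-refl
  (≤-trans (buildCost≤ n (stuckCost n n) (twins (markedRows G)) none)
    (*-monoʳ-≤ (states G) (+-monoˡ-≤ (K + stuckCost n n) (m≤n+m (n * nodeCost n) (nodeCost n)))))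

-- Turns a polynomial in `suc n` into one in the size of the input.
size-encodeList : ∀ {n} (f : Fin n → Tree) → n < size (encodeList f)
size-encodeList {zero}  f = z<s
size-encodeList {suc n} f = s≤s (≤-trans (size-encodeList (f ∘ suc)) (m≤n+m _ (size (f zero))))

-- Rational bounds

fromℕ-* : ∀ a b → fromℕ (a * b) ≡ fromℕ a *ℚ fromℕ b
fromℕ-* a b = ℚ.toℚᵘ-injective (begin
  toℚᵘ (fromℕ (a * b))                          ≈⟨ ℚ.toℚᵘ-fromℚᵘ (mkℚᵘ (ℤ.+ (a * b)) 0) ⟩
  mkℚᵘ (ℤ.+ (a * b)) 0                          ≈⟨ *≡* (cong (ℤ._* (ℤ.+ 1)) (ℤ.pos-* a b)) ⟩
  mkℚᵘ (ℤ.+ a) 0 ℚᵘ.* mkℚᵘ (ℤ.+ b) 0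
    ≈⟨ ℚᵘ.*-cong (ℚ.toℚᵘ-fromℚᵘ (mkℚᵘ (ℤ.+ a) 0)) (ℚ.toℚᵘ-fromℚᵘ (mkℚᵘ (ℤ.+ b) 0)) ⟨
  toℚᵘ (fromℕ a) ℚᵘ.* toℚᵘ (fromℕ b)            ≈⟨ ℚ.toℚᵘ-homo-* (fromℕ a) (fromℕ b) ⟨
  toℚᵘ (fromℕ a *ℚ fromℕ b)                     ∎)
  where open import Relation.Binary.Reasoning.Setoid ℚᵘ.≃-setoid

fromℕ-mono : ∀ {a b} → a ≤ b → fromℕ a ≤ℚ fromℕ b
fromℕ-mono {a} {b} a≤b = ℚ.toℚᵘ-cancel-≤ (begin
  toℚᵘ (fromℕ a)     ≃⟨ ℚ.toℚᵘ-fromℚᵘ (mkℚᵘ (ℤ.+ a) 0) ⟩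
  mkℚᵘ (ℤ.+ a) 0     ≤⟨ *≤* (ℤ.*-monoʳ-≤-nonNeg (ℤ.+ 1) (ℤ.+≤+ a≤b)) ⟩
  mkℚᵘ (ℤ.+ b) 0     ≃⟨ ℚ.toℚᵘ-fromℚᵘ (mkℚᵘ (ℤ.+ b) 0) ⟨
  toℚᵘ (fromℕ b)     ∎)
  where open ℚᵘ.≤-Reasoning

fromℕ-^ : ∀ a k → fromℕ (a ^ k) ≡ fromℕ a ℚ-Power.^ k
fromℕ-^ a zero    = refl
fromℕ-^ a (suc k) = trans (fromℕ-* a (a ^ k)) (cong (fromℕ a *ℚ_) (fromℕ-^ a k))

fromℕ-ratio : ∀ n ν .{{_ : NonZero ν}} → fromℕ ν *ℚ ((ℤ.+ n) ℚ./ ν ℚ.+ 1ℚ) ≡ fromℕ (n + ν)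
fromℕ-ratio n ν@(suc m) = ℚ.toℚᵘ-injective (begin
  toℚᵘ (fromℕ ν *ℚ ((ℤ.+ n) ℚ./ ν ℚ.+ 1ℚ))                ≈⟨ ℚ.toℚᵘ-homo-* (fromℕ ν) _ ⟩
  toℚᵘ (fromℕ ν) ℚᵘ.* toℚᵘ ((ℤ.+ n) ℚ./ ν ℚ.+ 1ℚ)
    ≈⟨ ℚᵘ.*-cong (ℚ.toℚᵘ-fromℚᵘ (mkℚᵘ (ℤ.+ ν) 0))
         (ℚᵘ.≃-trans (ℚ.toℚᵘ-homo-+ ((ℤ.+ n) ℚ./ ν) 1ℚ)
                     (ℚᵘ.+-congˡ ℚᵘ.1ℚᵘ (ℚ.toℚᵘ-fromℚᵘ (mkℚᵘ (ℤ.+ n) m)))) ⟩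
  mkℚᵘ (ℤ.+ ν) 0 ℚᵘ.* (mkℚᵘ (ℤ.+ n) m ℚᵘ.+ ℚᵘ.1ℚᵘ)        ≈⟨ *≡* numerators ⟩
  mkℚᵘ (ℤ.+ (n + ν)) 0                                    ≈⟨ ℚ.toℚᵘ-fromℚᵘ (mkℚᵘ (ℤ.+ (n + ν)) 0) ⟨
  toℚᵘ (fromℕ (n + ν))                                    ∎)
  where
  open import Relation.Binary.Reasoning.Setoid ℚᵘ.≃-setoid
  identity : ∀ x y → y ℤ.* (x ℤ.* ℤ.1ℤ ℤ.+ ℤ.1ℤ ℤ.* y) ℤ.* ℤ.1ℤ ≡ (x ℤ.+ y) ℤ.* y
  identity = ℤ-Solver.solve-∀
  numerators : ℤ.+ ν ℤ.* (ℤ.+ n ℤ.* ℤ.1ℤ ℤ.+ ℤ.1ℤ ℤ.* ℤ.+ ν) ℤ.* ℤ.1ℤ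
      ≡ ℤ.+ (n + ν) ℤ.* ℤ.+ (1 * (ν * 1))
  numerators = trans (identity (ℤ.+ n) (ℤ.+ ν))
    (cong (λ z → ℤ.+ (n + ν) ℤ.* ℤ.+ z) (sym (trans (*-identityˡ (ν * 1)) (*-identityʳ ν))))

-- The estimate `states≤` divided by ν^ν, using ν (n/ν + 1) = n + ν.
states≤bound : ∀ {n} (G : Graph n) ν .{{_ : NonZero ν}} → TwinPartition G ν →
    fromℕ (states G) ≤ℚ bound n ν
states≤bound {n} G ν P = ℚ.*-cancelˡ-≤-pos (fromℕ (ν ^ ν)) {{positive}} (begin
  fromℕ (ν ^ ν) *ℚ fromℕ (states G)         ≡⟨ fromℕ-* (ν ^ ν) (states G) ⟨
  fromℕ (ν ^ ν * states G)                  ≤⟨ fromℕ-mono (states≤ G P) ⟩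
  fromℕ ((n + ν) ^ ν)                       ≡⟨ fromℕ-^ (n + ν) ν ⟩
  fromℕ (n + ν) ℚ-Power.^ ν                 ≡⟨ cong (ℚ-Power._^ ν) (fromℕ-ratio n ν) ⟨
  (fromℕ ν *ℚ ratio) ℚ-Power.^ ν            ≡⟨ ^-distrib-* (fromℕ ν) ratio ν ⟩
  fromℕ ν ℚ-Power.^ ν *ℚ bound n ν          ≡⟨ cong (_*ℚ bound n ν) (fromℕ-^ ν ν) ⟨
  fromℕ (ν ^ ν) *ℚ bound n ν                ∎)
  where
  open ℚ.≤-Reasoning
  ratio = (ℤ.+ n) ℚ./ ν ℚ.+ 1ℚ
  positive : ℚ.Positive (fromℕ (ν ^ ν))
  positive = ℚ.normalize-pos (ν ^ ν) 1 {{_}} {{n^n≢0 ν}}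

within : ∀ {n} (G : Graph n) c k → (∀ n → costPerState n ≤ c * suc n ^ k) →
         ∀ {t} → t ≤ solverCost G → ∀ ν .{{_ : NonZero ν}} → TwinPartition G ν →
         fromℕ t ≤ℚ fromℕ (c * size (encodeGraph G) ^ k) *ℚ bound n ν
within {n} G c k cost≤ {t} t≤ ν P = begin
  fromℕ t                       ≤⟨ fromℕ-mono t≤C*states ⟩
  fromℕ (C * states G)          ≡⟨ fromℕ-* C (states G) ⟩
  fromℕ C *ℚ fromℕ (states G)
    ≤⟨ ℚ.*-monoˡ-≤-nonNeg (fromℕ C) {{ℚ.normalize-nonNeg C 1}} (states≤bound G ν P) ⟩
  fromℕ C *ℚ bound n ν          ∎
  where
  open ℚ.≤-Reasoning
  C = c * size (encodeGraph G) ^ k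
  costPerState≤C : costPerState n ≤ C
  costPerState≤C = ≤-trans (cost≤ n) (*-monoʳ-≤ c (^-monoˡ-≤ k (size-encodeList {n} _)))
  t≤C*states : t ≤ C * states G
  t≤C*states = ≤-trans t≤ (≤-trans (solverCost≤ G)
    (≤-trans (*-monoʳ-≤ (states G) costPerState≤C) (≤-reflexive (*-comm (states G) C))))

theorem5 : ∃[ P ] ∃[ c ] ∃[ k ]
    (∀ {n} (G : Graph n) →
    ∃[ winner ] ∃[ t ]
    (P On encodeGraph G Returns encodePlayer winner InTime t)
    × WinningStrategy winner G
    × (∀ ν .{{_ : NonZero ν}} → NeighborhoodDiversity G ν →
    fromℕ t ≤ℚ fromℕ (c * size (encodeGraph G) ^ k) *ℚ bound n ν))
theorem5 with poly-costPerState
... | c , k , cost≤ = solver , c , k , λ G →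
  let t , run , t≤ = solver-runs G in
  _ , t , run , secondWins-correct G , λ ν (P , _) → within G c k cost≤ t≤ ν P
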